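{- Let $r\ge 2$ and $d\ge 2$ be fixed integers, let $P_k^d$ be the $d$-dimensional grid on $n=k^d$ vertices. Then $\mathcal{D}_r(P_k^d,\mathcal{T}_n)=\Theta( k^{d-1} )$ as $k\to\infty$, where the implied constants depend only on $r$ and $d$.
   Context: $P_k^d$ is the graph on vertex set $[k]^d$ in which two vertices are adjacent iff they differ in exactly one coordinate, and in that coordinate they differ by exactly $1$. Spanning-tree discrepancy: for a connected $n$-vertex graph $G$, an $r$-colouring $f:E(G)\to[r]$ of its edges, and a spanning tree $T$ of $G$ (which has $n-1$ edges), put $D_f(T) := r\cdot\left(\max_{1\le i\le r}|f^{ -1}(i)\cap E(T)| - \frac{n-1}{r}\right)$. The $r$-colour spanning-tree discrepancy of $G$ is $\mathcal{D}_r(G,\mathcal{T}_n) := \min_{f:E(G)\to[r]}\ \max_{T} D_f(T)$, where the maximum is over all spanning trees $T$ of $G$. -}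

module Defs where

open import Data.Nat as ℕ using (ℕ; NonZero; ∣_-_∣)
open import Data.Integer as ℤ using (+_; 1ℤ)
open import Data.Rational as ℚ using (ℚ; _/_; _*_; _≤_)
open import Data.Fin using (Fin; toℕ; finToFun; _<?_)
open import Data.Fin.Properties using (_≟_; any?; all?)
open import Data.Fin.Subset using (Subset; _∈_; _∩_; ∣_∣)
open import Data.List using (List; _∷_; _∷ʳ_; length; lookup; filter; allFin; cartesianProduct; tabulate)
open import Data.List.Extrema.Nat using (max)
open import Data.List.Relation.Unary.Linked using (Linked)
open import Data.List.Relation.Unary.Unique.Propositional using (Unique)
import Data.Nat.Properties as ℕₚ
import Data.Vec as Vec
open import Data.Product using (Σ; ∃-syntax; _×_; _,_)
open import Data.Sum using (_⊎_)
open import Relation.Binary.Construct.Closure.ReflexiveTransitive using (Star)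
open import Relation.Binary.PropositionalEquality using (_≡_; _≢_; refl; sym; trans)
open import Relation.Nullary using (¬_; Dec; does)
open import Relation.Nullary.Decidable using (_×-dec_; _→-dec_; ¬?)

record Graph (n : ℕ) : Set₁ where
  field
    Adj    : Fin n → Fin n → Set
    adj?   : ∀ u v → Dec (Adj u v)
    symm   : ∀ {u v} → Adj u v → Adj v u
    irrefl : ∀ {u} → ¬ Adj u u

  -- Every edge {u , v} is listed once, as the pair (u , v) with u < v.
  edges : List (Fin n × Fin n)
  edges = filter (λ (u , v) → (u <? v) ×-dec adj? u v)
                 (cartesianProduct (allFin n) (allFin n))

  #E : ℕ
  #E = length edges

  Edge : Set
  Edge = Fin #E

  ends : Edge → Fin n × Fin n
  ends = lookup edges

  EdgeSet : Set
  EdgeSet = Subset #E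

  Link : EdgeSet → Fin n → Fin n → Set
  Link T u v = ∃[ e ] e ∈ T × (ends e ≡ (u , v) ⊎ ends e ≡ (v , u))

  Connected : EdgeSet → Set
  Connected T = ∀ u v → Star (Link T) u v

  -- A cycle of the spanning subgraph with edge set T: at least three distinct
  -- vertices x , xs, consecutive ones joined in T, and the last one joined to x.
  Cycle : EdgeSet → Set
  Cycle T = ∃[ x ] ∃[ xs ]
    2 ℕ.≤ length xs × Unique (x ∷ xs) × Linked (Link T) ((x ∷ xs) ∷ʳ x)

  SpanningTree : EdgeSet → Set
  SpanningTree T = Connected T × ¬ Cycle T

  Colouring : ℕ → Set
  Colouring r = Edge → Fin r

  colourClass : ∀ {r} → Colouring r → Fin r → EdgeSet
  colourClass f i = Vec.tabulate (λ e → does (f e ≟ i))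

  -- The default value 0 of max is harmless: r > 0 wherever this is used.
  largestClass : ∀ {r} → Colouring r → EdgeSet → ℕ
  largestClass f T = max 0 (tabulate (λ i → ∣ colourClass f i ∩ T ∣))

  treeDiscrepancy : ∀ {r} .{{_ : NonZero r}} → Colouring r → EdgeSet → ℚ
  treeDiscrepancy {r} f T =
    (+ r / 1) * ((+ largestClass f T / 1) ℚ.- ((+ n ℤ.- 1ℤ) / r))

open Graph

IsMaximum IsMinimum : (ℚ → Set) → ℚ → Set
IsMaximum P m = P m × (∀ x → P x → x ≤ m)
IsMinimum P m = P m × (∀ x → P x → m ≤ x)

module _ {n : ℕ} (G : Graph n) where

  IsMaxDiscrepancy : ∀ {r} .{{_ : NonZero r}} → Colouring G r → ℚ → Set
  IsMaxDiscrepancy f =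
    IsMaximum (λ x → ∃[ T ] SpanningTree G T × x ≡ treeDiscrepancy G f T)

  -- D is the value min_f max_T.  For a connected graph each colouring f has
  -- exactly one M with IsMaxDiscrepancy f M, so the minimum is over all f.
  IsDiscrepancy : (r : ℕ) .{{_ : NonZero r}} → ℚ → Set
  IsDiscrepancy r =
    IsMinimum (λ M → Σ (Colouring G r) λ f → IsMaxDiscrepancy f M)

GridAdj : ∀ {k d} → (Fin d → Fin k) → (Fin d → Fin k) → Set
GridAdj x y = ∃[ i ] ∣ toℕ (x i) - toℕ (y i) ∣ ≡ 1 × (∀ j → j ≢ i → x j ≡ y j)

-- finToFun is the library's bijection from Fin (k ^ d) to Fin d → Fin k.
grid : (k d : ℕ) → Graph (k ℕ.^ d)
grid k d = record
  { Adj    = λ u v → GridAdj (pt u) (pt v)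
  ; adj?   = λ u v → any? λ i →
      (∣ toℕ (pt u i) - toℕ (pt v i) ∣ ℕₚ.≟ 1)
        ×-dec all? (λ j → ¬? (j ≟ i) →-dec (pt u j ≟ pt v j))
  ; symm   = λ {u} {v} (i , p , q) →
      i , trans (ℕₚ.∣-∣-comm (toℕ (pt v i)) (toℕ (pt u i))) p , λ j j≢i → sym (q j j≢i)
  ; irrefl = λ {u} (i , p , _) → 0≢1 (trans (sym (ℕₚ.∣n-n∣≡0 (toℕ (pt u i)))) p)
  }
  where
  pt : Fin (k ℕ.^ d) → Fin d → Fin k
  pt = finToFun
  0≢1 : 0 ≢ 1
  0≢1 ()

{-# OPTIONS --safe #-}
module Submission where

-- Lower bound. Give every vertex a key such that every vertex except a root has a
-- neighbour of smaller key. Choosing one such "down" edge at every vertex gives a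
-- spanning tree, so colour i can be made to occur as often as there are vertices with a
-- down edge of colour i. Summing over i, some colour i and tree T satisfy
-- r |T ∩ i| ≥ n - 1 + #{v with down edges of two colours}. Apply this to the ℓ¹
-- distances from the 2^d corners of the grid, and call v impure if it has down edges of
-- two colours for one of them. All edges at a pure vertex have the same colour. If
-- there are at least ε k^(d-1) impure vertices, one corner yields the discrepancy.
-- Otherwise, for a suitable centre u, almost every v is connected to u by an axis-
-- parallel walk through pure vertices only; then all edges at v have the colour of u,
-- and the trees descending towards u are almost monochromatic.
--
-- Upper bound.  Colour r slabs of ⌊k/r⌋ + 1 layers each.  The edges of colour i in a
-- forest are at most as many as the vertices of the slab, widened by one layer.

open import Defs
open import Data.Bool using (true; false; if_then_else_)
open import Data.Fin as Fin
  using (Fin; zero; suc; toℕ; fromℕ; combine; quotient; remainder; finToFun; funToFin; _↑ˡ_; _↑ʳ_)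
import Data.Fin.Properties as Finₚ
open import Data.Fin.Properties using (_≟_; any?; all?)
open import Data.Fin.Subset using (Subset; _∈_; _∩_; ∣_∣)
open import Data.Fin.Subset.Properties using (_∈?_; x∈p∩q⁺; x∈p∩q⁻)
import Data.Integer as ℤ
import Data.Integer.Properties as ℤₚ
import Data.Integer.Tactic.RingSolver as ℤSolver
open import Data.List as List using (List; []; _∷_; _∷ʳ_; length; lookup; allFin; filter)
open import Data.List.Extrema.Nat using (max; xs≤max; max≤v⁺)
open import Data.List.Membership.Propositional using () renaming (_∈_ to _∈ₗ_; _∉_ to _∉ₗ_)
open import Data.List.Membership.Propositional.Properties
  using (∈-filter⁺; ∈-filter⁻; ∈-cartesianProduct⁺; ∈-allFin; ∈-lookup)
import Data.List.Properties as Listₚ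
open import Data.List.Relation.Unary.All as All using (All; []; _∷_)
import Data.List.Relation.Unary.All.Properties as Allₚ
open import Data.List.Relation.Unary.AllPairs using ([]; _∷_; allPairs?)
open import Data.List.Relation.Unary.Any as Any using (here; there)
import Data.List.Relation.Unary.Any.Properties as Anyₚ
open import Data.List.Relation.Unary.Linked as Linked using (Linked; [-]; _∷_)
open import Data.List.Relation.Unary.Unique.Propositional using (Unique)
import Data.List.Relation.Unary.Unique.Propositional.Properties as Uniqueₚ
open import Data.Maybe using (Maybe; just; nothing)
import Data.Maybe.Properties as Maybeₚ
open import Data.Nat as ℕ using (ℕ; zero; suc; z≤n; s≤s; NonZero; ∣_-_∣)
open import Data.Nat.DivMod using (_%_; m/n*n≤m; m%n<n; m≡m%n+[m/n]*n; m<n*o⇒m/o<n)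
import Data.Nat.Properties as ℕₚ
open import Data.Nat.Tactic.RingSolver using (solve-∀)
open import Data.Product using (Σ; ∃-syntax; _×_; _,_; proj₁; proj₂; uncurry)
import Data.Product.Properties as Productₚ
import Data.Rational as ℚ
import Data.Rational.Properties as ℚₚ
open import Data.Rational.Unnormalised as ℚᵘ using (mkℚᵘ; _≃_; *≡*; *≤*)
import Data.Rational.Unnormalised.Properties as ℚᵘₚ
open import Data.Sum using (_⊎_; inj₁; inj₂; [_,_]′; swap)
open import Data.Unit using (tt)
import Data.Vec as Vec
open import Data.Vec.Functional using (updateAt)
import Data.Vec.Functional.Properties as VecFₚ
import Data.Vec.Properties as Vecₚ
open import Function using (_∘_; id)
open import Level using (0ℓ)
open import Relation.Binary using (Rel; Reflexive; Transitive; Total; tri<; tri≈; tri>)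
open import Relation.Binary.Construct.Closure.ReflexiveTransitive as Star using (Star; ε; _◅_; _◅◅_)
open import Relation.Binary.PropositionalEquality
open import Relation.Nullary using (¬_; Dec; yes; no; does; contradiction)
import Relation.Nullary.Decidable as Dec
open import Relation.Nullary.Decidable using (_×-dec_; _⊎-dec_; ¬?; dec-true; decidable-stable)
open import Algebra.Properties.CommutativeMonoid.Sum ℕₚ.+-0-commutativeMonoid
  using (sum; sum-cong-≗; ∑-comm; ∑-distrib-+)

-- In this module, unqualified arithmetic and order symbols refer to ℕ; below it, to ℚ.
module _ where
  open import Data.Nat using (_+_; _*_; _∸_; _^_; _/_; _≤_; _<_)
  open ℚ using (ℚ)

  -- Counting by sums of indicators, and averaging.

  𝟙 : ∀ {P : Set} → Dec P → ℕ
  𝟙 d = if does d then 1 else 0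

  𝟙-yes : ∀ {P : Set} (d : Dec P) → P → 𝟙 d ≡ 1
  𝟙-yes (yes _) p = refl
  𝟙-yes (no ¬p) p = contradiction p ¬p

  𝟙-no : ∀ {P : Set} (d : Dec P) → ¬ P → 𝟙 d ≡ 0
  𝟙-no (yes p) ¬p = contradiction p ¬p
  𝟙-no (no _)  ¬p = refl

  𝟙-≡0 : ∀ {P : Set} (d : Dec P) → 𝟙 d ≡ 0 → ¬ P
  𝟙-≡0 d 𝟙≡0 p with () ← trans (sym 𝟙≡0) (𝟙-yes d p)

  𝟙-mono : ∀ {P : Set} (d : Dec P) {m} → (P → 1 ≤ m) → 𝟙 d ≤ m
  𝟙-mono (yes p) f = f p
  𝟙-mono (no _)  f = z≤n

  count : ∀ {n} {P : Fin n → Set} → (∀ i → Dec (P i)) → ℕ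
  count P? = sum (λ i → 𝟙 (P? i))

  sum-mono-≤ : ∀ {n} {f g : Fin n → ℕ} → (∀ i → f i ≤ g i) → sum f ≤ sum g
  sum-mono-≤ {zero}  f≤g = z≤n
  sum-mono-≤ {suc n} f≤g = ℕₚ.+-mono-≤ (f≤g zero) (sum-mono-≤ (f≤g ∘ suc))

  sum-mono-< : ∀ {n} {f g : Fin n → ℕ} → (∀ i → f i ≤ g i) →
               ∀ j → f j < g j → sum f < sum g
  sum-mono-< f≤g zero    f<g = ℕₚ.+-mono-<-≤ f<g (sum-mono-≤ (f≤g ∘ suc))
  sum-mono-< f≤g (suc j) f<g = ℕₚ.+-mono-≤-< (f≤g zero) (sum-mono-< (f≤g ∘ suc) j f<g)

  term≤sum : ∀ {n} (f : Fin n → ℕ) i → f i ≤ sum f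
  term≤sum f zero    = ℕₚ.m≤m+n _ _
  term≤sum f (suc i) = ℕₚ.≤-trans (term≤sum (f ∘ suc) i) (ℕₚ.m≤n+m _ _)

  sum-const : ∀ n c → sum {n} (λ _ → c) ≡ n * c
  sum-const zero    c = refl
  sum-const (suc n) c = cong (c +_) (sum-const n c)

  sum-*ˡ : ∀ {n} c (f : Fin n → ℕ) → sum (λ i → c * f i) ≡ c * sum f
  sum-*ˡ {zero}  c f = sym (ℕₚ.*-zeroʳ c)
  sum-*ˡ {suc n} c f =
    trans (cong (c * f zero +_) (sum-*ˡ c (f ∘ suc))) (sym (ℕₚ.*-distribˡ-+ c _ _))

  sum≤* : ∀ {n} {f : Fin n → ℕ} {c} → (∀ i → f i ≤ c) → sum f ≤ n * c
  sum≤* {n} {f} {c} f≤c = subst (sum f ≤_) (sum-const n c) (sum-mono-≤ f≤c)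

  *≤sum : ∀ {n} {f : Fin n → ℕ} {c} → (∀ i → c ≤ f i) → n * c ≤ sum f
  *≤sum {n} {f} {c} c≤f = subst (_≤ sum f) (sum-const n c) (sum-mono-≤ c≤f)

  sum-0 : ∀ {n} {f : Fin n → ℕ} → (∀ i → f i ≡ 0) → sum f ≡ 0
  sum-0 {zero}  f≡0 = refl
  sum-0 {suc n} f≡0 = cong₂ _+_ (f≡0 zero) (sum-0 (f≡0 ∘ suc))

  sum-+ : ∀ m {n} (f : Fin (m + n) → ℕ) →
          sum f ≡ sum (λ i → f (i ↑ˡ n)) + sum (λ j → f (m ↑ʳ j))
  sum-+ zero    f = refl
  sum-+ (suc m) f = trans (cong (f zero +_) (sum-+ m (f ∘ suc))) (sym (ℕₚ.+-assoc (f zero) _ _))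

  sum-combine : ∀ m {n} (f : Fin (m * n) → ℕ) →
                sum f ≡ sum (λ i → sum (λ j → f (combine {m} {n} i j)))
  sum-combine zero        f = refl
  sum-combine (suc m) {n} f =
    trans (sum-+ n f) (cong (sum (λ j → f (j ↑ˡ m * n)) +_) (sum-combine m (λ j → f (n ↑ʳ j))))

  count-unique≤1 : ∀ {n} {P : Fin n → Set} (P? : ∀ i → Dec (P i)) →
                   (∀ i j → P i → P j → i ≡ j) → count P? ≤ 1
  count-unique≤1 {zero}  P? uniq = z≤n
  count-unique≤1 {suc n} P? uniq with P? zero
  ... | no _   = count-unique≤1 (P? ∘ suc) λ i j p q → suc-inj (uniq _ _ p q)
    where
    suc-inj : ∀ {n} {i j : Fin n} → suc i ≡ suc j → i ≡ j
    suc-inj refl = refl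
  ... | yes p₀ = s≤s (ℕₚ.≤-reflexive
    (sum-0 λ i → 𝟙-no (P? (suc i)) λ p → contradiction (uniq zero (suc i) p₀ p) λ ()))

  -- Double counting of the pairs `(i , j)` with `h i ≡ just j` and `Q j`: a row with `P i` holds at
  -- least one of them, a column with `Q j` at most one. The map is partial because it will send a
  -- vertex to its parent edge, and a root has none.
  count-injection :
    ∀ {m n} {P : Fin m → Set} {Q : Fin n → Set}
    (P? : ∀ i → Dec (P i)) (Q? : ∀ j → Dec (Q j)) (h : Fin m → Maybe (Fin n)) →
    (∀ i → P i → ∃[ j ] h i ≡ just j × Q j) →
    (∀ {i i′ j} → h i ≡ just j → h i′ ≡ just j → i ≡ i′) →
    count P? ≤ count Q?
  count-injection P? Q? h h-maps h-inj = begin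
    count P?                                  ≤⟨ sum-mono-≤ (λ i → 𝟙-mono (P? i) (row i)) ⟩
    sum (λ i → sum (λ j → 𝟙 (R? i j)))        ≡⟨ ∑-comm (λ i j → 𝟙 (R? i j)) ⟩
    sum (λ j → sum (λ i → 𝟙 (R? i j)))        ≤⟨ sum-mono-≤ col ⟩
    count Q?                                  ∎
    where
    open ℕₚ.≤-Reasoning
    R? : ∀ i j → Dec (h i ≡ just j × _)
    R? i j = Maybeₚ.≡-dec _≟_ (h i) (just j) ×-dec Q? j
    row : ∀ i → _ → 1 ≤ sum (λ j → 𝟙 (R? i j))
    row i p with h-maps i p
    ... | j , r = ℕₚ.≤-trans (ℕₚ.≤-reflexive (sym (𝟙-yes (R? i j) r))) (term≤sum _ j)
    col : ∀ j → count (λ i → R? i j) ≤ 𝟙 (Q? j)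
    col j with Q? j in eq
    ... | yes q = count-unique≤1 (λ i → Maybeₚ.≡-dec _≟_ (h i) (just j) ×-dec yes q)
                    (λ _ _ p p′ → h-inj (proj₁ p) (proj₁ p′))
    ... | no ¬q = ℕₚ.≤-reflexive
      (sum-0 λ i → 𝟙-no (Maybeₚ.≡-dec _≟_ (h i) (just j) ×-dec no ¬q) (¬q ∘ proj₂))

  -- Stated for any total preorder, so that one search yields maxima and minima, over ℕ and over ℚ.
  extremum : ∀ {A : Set} {_≼_ : Rel A 0ℓ} → Reflexive _≼_ → Transitive _≼_ → Total _≼_ →
             ∀ {n} {P : Fin n → Set} → (∀ i → Dec (P i)) → (h : Fin n → A) → ∃[ i ] P i →
             ∃[ i ] P i × (∀ j → P j → h j ≼ h i)
  extremum {A} {_≼_} ≼-refl ≼-trans ≼-total = go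
    where
    go : ∀ {n} {P : Fin n → Set} → (∀ i → Dec (P i)) → (h : Fin n → A) → ∃[ i ] P i →
         ∃[ i ] P i × (∀ j → P j → h j ≼ h i)
    go {suc n} {P} P? h (i , p) with any? (P? ∘ suc)
    ... | no none = zero , p₀ i p ,
          λ { zero _ → ≼-refl ; (suc j) q → contradiction (j , q) none }
      where
      p₀ : ∀ i → P i → P zero
      p₀ zero    p = p
      p₀ (suc i) p = contradiction (i , p) none
    ... | yes some with go (P? ∘ suc) (h ∘ suc) some
    ...   | j , q , j-max with P? zero
    ...     | no ¬p₀ = suc j , q , λ { zero p₀ → contradiction p₀ ¬p₀ ; (suc i) → j-max i }
    ...     | yes p₀ with ≼-total (h zero) (h (suc j))
    ...       | inj₁ 0≼j = suc j , q , λ { zero _ → 0≼j ; (suc i) → j-max i }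
    ...       | inj₂ j≼0 = zero , p₀ , λ { zero _ → ≼-refl ; (suc i) r → ≼-trans (j-max i r) j≼0 }

  pigeonhole : ∀ {n} .{{_ : NonZero n}} (f : Fin n → ℕ) → ∃[ i ] sum f ≤ n * f i
  pigeonhole {suc n} f
    with i , _ , max ← extremum {_≼_ = _≤_} ℕₚ.≤-refl ℕₚ.≤-trans ℕₚ.≤-total (λ _ → yes tt) f (zero , tt)
    = i , sum≤* (λ j → max j tt)

  below-average : ∀ {n} .{{_ : NonZero n}} (f : Fin n → ℕ) → ∃[ i ] n * f i ≤ sum f
  below-average {suc n} f
    with i , _ , min ← extremum {_≼_ = ℕ._≥_} ℕₚ.≤-refl (λ p q → ℕₚ.≤-trans q p)
                         (λ x y → ℕₚ.≤-total y x) (λ _ → yes tt) f (zero , tt)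
    = i , *≤sum (λ j → min j tt)

  count-interval : ∀ n lo len →
    count {n} (λ i → (lo ℕₚ.≤? toℕ i) ×-dec (toℕ i ℕₚ.<? lo + len)) ≤ len
  count-interval zero    lo       len       = z≤n
  count-interval (suc n) zero     zero      = ℕₚ.≤-reflexive (sum-0 {n} λ _ → refl)
  count-interval (suc n) zero     (suc len) = s≤s (ℕₚ.≤-trans
    (sum-mono-≤ {n} λ i → 𝟙-mono ((0 ℕₚ.≤? suc (toℕ i)) ×-dec (suc (toℕ i) ℕₚ.<? suc len))
       λ { (_ , s≤s lt) → ℕₚ.≤-reflexive (sym (𝟙-yes ((0 ℕₚ.≤? toℕ i) ×-dec (toℕ i ℕₚ.<? len)) (z≤n , lt))) })
    (count-interval n zero len))
  count-interval (suc n) (suc lo) len       = ℕₚ.≤-trans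
    (sum-mono-≤ {n} λ i → 𝟙-mono ((suc lo ℕₚ.≤? suc (toℕ i)) ×-dec (suc (toℕ i) ℕₚ.<? suc lo + len))
       λ { (s≤s le , s≤s lt) → ℕₚ.≤-reflexive (sym (𝟙-yes ((lo ℕₚ.≤? toℕ i) ×-dec (toℕ i ℕₚ.<? lo + len)) (le , lt))) })
    (count-interval n lo len)

  -- Decidable subsets and lists without repetition.

  ∈-tabulate-does⁺ : ∀ {m} {P : Fin m → Set} (P? : ∀ i → Dec (P i)) {i} →
                     P i → i ∈ Vec.tabulate (does ∘ P?)
  ∈-tabulate-does⁺ P? {i} p =
    Vecₚ.lookup⇒[]= i _ (trans (Vecₚ.lookup∘tabulate (does ∘ P?) i) (dec-true (P? i) p))

  ∈-tabulate-does⁻ : ∀ {m} {P : Fin m → Set} (P? : ∀ i → Dec (P i)) {i} →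
                     i ∈ Vec.tabulate (does ∘ P?) → P i
  ∈-tabulate-does⁻ P? {i} i∈
    with P? i | trans (sym (Vecₚ.lookup∘tabulate (does ∘ P?) i)) (Vecₚ.[]=⇒lookup i∈)
  ... | yes p | _  = p
  ... | no _  | ()

  ∣∣≡count : ∀ {m} (p : Subset m) → ∣ p ∣ ≡ count (_∈? p)
  ∣∣≡count Vec.[]              = refl
  ∣∣≡count (true  Vec.∷ p) = cong suc (∣∣≡count p)
  ∣∣≡count (false Vec.∷ p) = ∣∣≡count p

  lookup-injective : ∀ {A : Set} {xs : List A} → Unique xs →
                     ∀ {i j} → lookup xs i ≡ lookup xs j → i ≡ j
  lookup-injective (_  ∷ _)  {zero}  {zero}  eq = refl
  lookup-injective (x∉ ∷ _)  {zero}  {suc j} eq = contradiction eq (All.lookup x∉ (∈-lookup j))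
  lookup-injective (x∉ ∷ _)  {suc i} {zero}  eq = contradiction (sym eq) (All.lookup x∉ (∈-lookup i))
  lookup-injective (_  ∷ un) {suc i} {suc j} eq = cong suc (lookup-injective un eq)

  two-terms≤sum : ∀ {m} (f : Fin m → ℕ) {i j} → i ≢ j → f i + f j ≤ sum f
  two-terms≤sum f {zero}  {zero}  i≢j = contradiction refl i≢j
  two-terms≤sum f {zero}  {suc j} i≢j = ℕₚ.+-monoʳ-≤ (f zero) (term≤sum (f ∘ suc) j)
  two-terms≤sum f {suc i} {zero}  i≢j =
    subst (_≤ sum f) (ℕₚ.+-comm (f zero) _) (ℕₚ.+-monoʳ-≤ (f zero) (term≤sum (f ∘ suc) i))
  two-terms≤sum f {suc i} {suc j} i≢j =
    ℕₚ.≤-trans (two-terms≤sum (f ∘ suc) (i≢j ∘ cong suc)) (ℕₚ.m≤n+m _ (f zero))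

  -- Closed walks in parent-pointer forests.

  final : ∀ {A : Set} → A → List A → A
  final x []       = x
  final x (y ∷ ys) = final y ys

  final-∈ : ∀ {A : Set} (x : A) ys → final x ys ∈ₗ x ∷ ys
  final-∈ x []       = here refl
  final-∈ x (y ∷ ys) = there (final-∈ y ys)

  linked-∷ʳ : ∀ {A : Set} {R : A → A → Set} {x z} ys →
              Linked R (x ∷ ys) → R (final x ys) z → Linked R (x ∷ ys ∷ʳ z)
  linked-∷ʳ []       [-]       r = r ∷ [-]
  linked-∷ʳ (y ∷ ys) (xy ∷ li) r = xy ∷ linked-∷ʳ ys li r

  -- A closed walk without backtracking in a parent-pointer forest cannot exist:
  -- once it moves from a parent to a child it can only continue that way, so it
  -- descends and then climbs, and it leaves its base point to the same vertex
  -- from which it returns.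
  module ParentForest {V : Set} (Par : V → V → Set) (key : V → ℕ)
    (par-< : ∀ {p c} → Par p c → key p < key c)
    (par-unique : ∀ {p q c} → Par p c → Par q c → p ≡ q) where

    Step : V → V → Set
    Step u v = Par u v ⊎ Par v u

    data NonBacktracking : List V → Set where
      short : ∀ {u v} → NonBacktracking (u ∷ v ∷ [])
      step  : ∀ {u v w vs} → u ≢ w → NonBacktracking (v ∷ w ∷ vs) →
              NonBacktracking (u ∷ v ∷ w ∷ vs)

    nonBacktracking-∷ʳ : ∀ u vs {z} → Unique (u ∷ vs) → z ∉ₗ u ∷ vs → NonBacktracking (u ∷ vs ∷ʳ z)
    nonBacktracking-∷ʳ u []           un z∉ = short
    nonBacktracking-∷ʳ u (v ∷ [])     un z∉ = step (λ u≡z → z∉ (here (sym u≡z))) short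
    nonBacktracking-∷ʳ u (v ∷ w ∷ vs) ((_ ∷ u≢w ∷ _) ∷ un) z∉ =
      step u≢w (nonBacktracking-∷ʳ v (w ∷ vs) un (z∉ ∘ there))

    climbing : ∀ {u v z} vs → Par u v → Linked Step (v ∷ vs ∷ʳ z) →
               NonBacktracking (u ∷ v ∷ vs ∷ʳ z) → key u < key z × Par (final v vs) z
    climbing []       uv (inj₁ vz ∷ [-]) _            = ℕₚ.<-trans (par-< uv) (par-< vz) , vz
    climbing []       uv (inj₂ zv ∷ [-]) (step u≢z _) = contradiction (par-unique uv zv) u≢z
    climbing (w ∷ vs) uv (inj₁ vw ∷ li)  (step _ nb)  with climbing vs vw li nb
    ... | v<z , p = ℕₚ.<-trans (par-< uv) v<z , p
    climbing (w ∷ vs) uv (inj₂ wv ∷ li)  (step u≢w _) = contradiction (par-unique uv wv) u≢w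

    -- The key drops as long as every step goes to the parent. From the first step to a child on,
    -- `climbing` applies, so the walk also ends with a step to a child.
    descending : ∀ {u v z} vs → Par v u → Linked Step (v ∷ vs ∷ʳ z) →
                 NonBacktracking (u ∷ v ∷ vs ∷ʳ z) → key z < key u ⊎ Par (final v vs) z
    descending []       vu (inj₁ vz ∷ [-]) _           = inj₂ vz
    descending []       vu (inj₂ zv ∷ [-]) _           = inj₁ (ℕₚ.<-trans (par-< zv) (par-< vu))
    descending (w ∷ vs) vu (inj₁ vw ∷ li)  (step _ nb) = inj₂ (proj₂ (climbing vs vw li nb))
    descending (w ∷ vs) vu (inj₂ wv ∷ li)  (step _ nb) with descending vs wv li nb
    ... | inj₁ z<v = inj₁ (ℕₚ.<-trans z<v (par-< vu))
    ... | inj₂ p   = inj₂ p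

    acyclic : ∀ {x} xs → 2 ≤ length xs → Unique (x ∷ xs) → ¬ Linked Step ((x ∷ xs) ∷ʳ x)
    acyclic {x} (y ∷ z ∷ zs) _ un@((_ ∷ x≢z ∷ _) ∷ un-ys@(y∉ ∷ _)) (xy ∷ li) = go xy
      where
      nb : NonBacktracking (x ∷ y ∷ z ∷ zs ∷ʳ x)
      nb = step x≢z (nonBacktracking-∷ʳ y (z ∷ zs) un-ys (Uniqueₚ.Unique[x∷xs]⇒x∉xs un))
      go : ¬ Step x y
      go (inj₁ par) = ℕₚ.<-irrefl refl (proj₁ (climbing (z ∷ zs) par li nb))
      go (inj₂ par) with descending (z ∷ zs) par li nb
      ... | inj₁ x<x = ℕₚ.<-irrefl refl x<x
      -- Both `y` and the last vertex before the return are parents of `x`, so they coincide,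
      -- against the distinctness of the vertices.
      ... | inj₂ p   = contradiction (par-unique par p) (All.lookup y∉ (final-∈ z zs))
    acyclic (_ ∷ []) (s≤s ())

  -- Edges of a graph, and spanning trees that descend along a key.

  module GraphProperties {n : ℕ} (G : Graph n) where
    open Graph G

    Joins : Edge → Fin n → Fin n → Set
    Joins e u v = ends e ≡ (u , v) ⊎ ends e ≡ (v , u)

    joins? : ∀ e u v → Dec (Joins e u v)
    joins? e u v = ends≟ (u , v) ⊎-dec ends≟ (v , u)
      where ends≟ = Productₚ.≡-dec _≟_ _≟_ (ends e)

    edge? : ∀ (p : Fin n × Fin n) → Dec (proj₁ p Fin.< proj₂ p × Adj (proj₁ p) (proj₂ p))
    edge? (u , v) = (u Fin.<? v) ×-dec adj? u v

    edges-unique : Unique edges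
    edges-unique = Uniqueₚ.filter⁺ edge? (Uniqueₚ.cartesianProduct⁺ (Uniqueₚ.allFin⁺ n) (Uniqueₚ.allFin⁺ n))

    ends-valid : ∀ e → proj₁ (ends e) Fin.< proj₂ (ends e) × Adj (proj₁ (ends e)) (proj₂ (ends e))
    ends-valid e = proj₂ (∈-filter⁻ edge? {xs = List.cartesianProduct (allFin n) (allFin n)} (∈-lookup e))

    private
      listed : ∀ {u v} → u Fin.< v → Adj u v → ∃[ e ] ends e ≡ (u , v)
      listed {u} {v} u<v uv = Any.index uv∈ , sym (Anyₚ.lookup-index uv∈)
        where
        uv∈ : (u , v) ∈ₗ edges
        uv∈ = ∈-filter⁺ edge? (∈-cartesianProduct⁺ (∈-allFin u) (∈-allFin v)) (u<v , uv)

    adj⇒edge : ∀ {u v} → Adj u v → ∃[ e ] Joins e u v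
    adj⇒edge {u} {v} uv with Finₚ.<-cmp u v
    ... | tri< u<v _ _  = let e , eq = listed u<v uv in e , inj₁ eq
    ... | tri≈ _ refl _ = contradiction uv irrefl
    ... | tri> _ _ v<u  = let e , eq = listed v<u (symm uv) in e , inj₂ eq

    edge⇒adj : ∀ {e u v} → Joins e u v → Adj u v
    edge⇒adj {e} (inj₁ eq) = subst (uncurry Adj) eq (proj₂ (ends-valid e))
    edge⇒adj {e} (inj₂ eq) = symm (subst (uncurry Adj) eq (proj₂ (ends-valid e)))

    joins-distinct : ∀ {e u} → ¬ Joins e u u
    joins-distinct j = irrefl (edge⇒adj j)

    joins-other : ∀ {e u v w} → Joins e u v → Joins e u w → v ≡ w
    joins-other (inj₁ p) (inj₁ q) = cong proj₂ (trans (sym p) q)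
    joins-other (inj₁ p) (inj₂ q) =
      trans (cong proj₂ (trans (sym p) q)) (cong proj₁ (trans (sym p) q))
    joins-other (inj₂ p) (inj₁ q) =
      trans (cong proj₁ (trans (sym p) q)) (cong proj₂ (trans (sym p) q))
    joins-other (inj₂ p) (inj₂ q) = cong proj₁ (trans (sym p) q)

    joins-unique : ∀ {e e′ u v} → Joins e u v → Joins e′ u v → e ≡ e′
    joins-unique (inj₁ p) (inj₁ q) = lookup-injective edges-unique (trans p (sym q))
    joins-unique (inj₂ p) (inj₂ q) = lookup-injective edges-unique (trans p (sym q))
    joins-unique {e} {e′} (inj₁ p) (inj₂ q) = contradiction
      (subst (uncurry Fin._<_) q (proj₁ (ends-valid e′)))
      (Finₚ.<-asym (subst (uncurry Fin._<_) p (proj₁ (ends-valid e))))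
    joins-unique {e} {e′} (inj₂ p) (inj₁ q) = contradiction
      (subst (uncurry Fin._<_) q (proj₁ (ends-valid e′)))
      (Finₚ.<-asym (subst (uncurry Fin._<_) p (proj₁ (ends-valid e))))

    -- `Link T` is the instance `_∈ T`; with a general predicate, walks along a list of edges are
    -- covered too.
    Connects : (Edge → Set) → Fin n → Fin n → Set
    Connects P u v = ∃[ e ] P e × Joins e u v

    connects-sym : ∀ {P u v} → Connects P u v → Connects P v u
    connects-sym (e , p , j) = e , p , swap j

    module _ (key : Fin n → ℕ) where

      Down : Fin n → Edge → Set
      Down v e = ∃[ w ] Joins e v w × key w < key v

      down? : ∀ v e → Dec (Down v e)
      down? v e = any? λ w → joins? e v w ×-dec (key w ℕₚ.<? key v)

      module _ {r : ℕ} (f : Colouring r) where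

        HasDown : Fin r → Fin n → Set
        HasDown i v = ∃[ e ] Down v e × f e ≡ i

        hasDown? : ∀ i v → Dec (HasDown i v)
        hasDown? i v = any? λ e → down? v e ×-dec (f e ≟ i)

        Bichromatic : Fin n → Set
        Bichromatic v = ∃[ e ] ∃[ e′ ] Down v e × Down v e′ × f e ≢ f e′

        bichromatic? : ∀ v → Dec (Bichromatic v)
        bichromatic? v = any? λ e → any? λ e′ → down? v e ×-dec down? v e′ ×-dec ¬? (f e ≟ f e′)

      module _ {root : Fin n} (down-or-root : ∀ v → v ≡ root ⊎ ∃[ e ] Down v e) where

        module TreeFavouring {r : ℕ} (f : Colouring r) (i : Fin r) where

          -- A down edge of colour `i` takes precedence over all others. The value carries its
          -- specification, so that later proofs do not repeat the case distinction: the second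
          -- property yields connectivity, the third the count of colour `i`.
          choose : ∀ v → Σ (Maybe Edge) λ m →
            (∀ {e} → m ≡ just e → Down v e) ×
            (v ≡ root ⊎ ∃[ e ] m ≡ just e) ×
            (HasDown f i v → ∃[ e ] m ≡ just e × f e ≡ i)
          choose v with hasDown? f i v
          ... | yes (e , d , fe) = just e , (λ { refl → d }) , inj₂ (e , refl) , λ _ → e , refl , fe
          ... | no none with down-or-root v
          ...   | inj₂ (e , d) = just e , (λ { refl → d }) , inj₂ (e , refl) , λ h → contradiction h none
          ...   | inj₁ eq      = nothing , (λ ()) , inj₁ eq , λ h → contradiction h none

          parentEdge : Fin n → Maybe Edge
          parentEdge v = proj₁ (choose v)

          parentEdge-down : ∀ {v e} → parentEdge v ≡ just e → Down v e
          parentEdge-down {v} = proj₁ (proj₂ (choose v))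

          chosen? : ∀ e → Dec (∃[ v ] parentEdge v ≡ just e)
          chosen? e = any? λ v → Maybeₚ.≡-dec _≟_ (parentEdge v) (just e)

          tree : EdgeSet
          tree = Vec.tabulate (does ∘ chosen?)

          Par : Fin n → Fin n → Set
          Par p c = ∃[ e ] parentEdge c ≡ just e × Joins e c p

          par-< : ∀ {p c} → Par p c → key p < key c
          par-< (e , eq , j) with parentEdge-down eq
          ... | w , j′ , w<c = subst (λ x → key x < _) (joins-other j′ j) w<c

          par-unique : ∀ {p q c} → Par p c → Par q c → p ≡ q
          par-unique (e , eq , j) (e′ , eq′ , j′)
            with refl ← Maybeₚ.just-injective (trans (sym eq) eq′) = joins-other j j′

          open ParentForest Par key par-< par-unique

          -- A tree edge was chosen by one of its ends, and that end is the child. The four cases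
          -- match the two orientations in which the edge is read.
          link⇒step : ∀ {u v} → Link tree u v → Step u v
          link⇒step {u} {v} (e , e∈ , j) with ∈-tabulate-does⁻ chosen? e∈
          ... | c , eq with parentEdge-down eq
          ...   | w , j′ , _ = go j j′
            where
            go : Joins e u v → Joins e c w → Step u v
            go (inj₁ p) (inj₁ q) with refl ← trans (sym p) q = inj₂ (e , eq , inj₁ p)
            go (inj₁ p) (inj₂ q) with refl ← trans (sym p) q = inj₁ (e , eq , inj₂ p)
            go (inj₂ p) (inj₁ q) with refl ← trans (sym p) q = inj₁ (e , eq , inj₁ p)
            go (inj₂ p) (inj₂ q) with refl ← trans (sym p) q = inj₂ (e , eq , inj₂ p)

          -- `m` is fuel: each parent edge lowers the key, and a vertex without parent edge is the
          -- root.
          to-root : ∀ m v → key v < m → Star (Link tree) v root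
          to-root (suc m) v v<m with proj₁ (proj₂ (proj₂ (choose v)))
          ... | inj₁ refl     = ε
          ... | inj₂ (e , eq) with parentEdge-down eq
          ...   | w , j , w<v = (e , ∈-tabulate-does⁺ chosen? (v , eq) , j)
                                ◅ to-root m w (ℕₚ.<-≤-trans w<v (ℕₚ.≤-pred v<m))

          tree-spanning : SpanningTree tree
          tree-spanning =
            (λ u v → to-root _ u ℕₚ.≤-refl ◅◅ Star.reverse connects-sym (to-root _ v ℕₚ.≤-refl)) ,
            λ (x , xs , 2≤ , un , li) → acyclic xs 2≤ un (Linked.map link⇒step li)

          -- If both ends chose the same edge, each would have a smaller key than the other.
          parentEdge-injective : ∀ {u v e} → parentEdge u ≡ just e → parentEdge v ≡ just e → u ≡ v
          parentEdge-injective eq eq′ with parentEdge-down eq | parentEdge-down eq′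
          ... | w , j , w<u | w′ , j′ , w′<v = go j j′
            where
            go : Joins _ _ w → Joins _ _ w′ → _
            go (inj₁ p) (inj₁ q) = cong proj₁ (trans (sym p) q)
            go (inj₂ p) (inj₂ q) = cong proj₂ (trans (sym p) q)
            go (inj₁ p) (inj₂ q) with refl ← trans (sym p) q = contradiction w<u (ℕₚ.<-asym w′<v)
            go (inj₂ p) (inj₁ q) with refl ← trans (sym p) q = contradiction w<u (ℕₚ.<-asym w′<v)

          count≤tree : count (hasDown? f i) ≤ ∣ colourClass f i ∩ tree ∣
          count≤tree = subst (count (hasDown? f i) ≤_) (sym (∣∣≡count (colourClass f i ∩ tree)))
            (count-injection (hasDown? f i) (_∈? (colourClass f i ∩ tree)) parentEdge
              (λ v h → let e , eq , fe = proj₂ (proj₂ (proj₂ (choose v))) h in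
                e , eq , x∈p∩q⁺ (∈-tabulate-does⁺ (λ e → f e ≟ i) fe ,
                                 ∈-tabulate-does⁺ chosen? (v , eq)))
              parentEdge-injective)

        -- The favoured colour is the one with down edges at the most vertices. Hence `r` times its
        -- count is at least the number of pairs of a vertex and a colour among its down edges.
        bichromatic-excess : ∀ {r} .{{_ : NonZero r}} (f : Colouring r) →
          ∃[ i ] ∃[ T ] SpanningTree T ×
            n + count (bichromatic? f) ≤ 1 + r * ∣ colourClass f i ∩ T ∣
        bichromatic-excess {r} f with pigeonhole (λ i → count (hasDown? f i))
        ... | i , heavy = i , tree , tree-spanning , bound
          where
          open TreeFavouring f i
          open ℕₚ.≤-Reasoning
          colours : Fin n → ℕ
          colours v = sum (λ j → 𝟙 (hasDown? f j v))
          has-colour : ∀ {v e} → Down v e → 𝟙 (hasDown? f (f e) v) ≡ 1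
          has-colour {v} {e} d = 𝟙-yes (hasDown? f (f e) v) (e , d , refl)
          -- A bichromatic vertex sees two colours on its down edges, every other vertex with a down
          -- edge at least one. The root may have none; its indicator makes up for this and becomes
          -- the `1 +` of the bound.
          local : ∀ v → 1 + 𝟙 (bichromatic? f v) ≤ 𝟙 (v ≟ root) + colours v
          local v with bichromatic? f v
          ... | yes (e , e′ , d , d′ , fe≢fe′) = ℕₚ.≤-trans
            (subst₂ (λ a b → a + b ≤ colours v) (has-colour d) (has-colour d′)
              (two-terms≤sum (λ j → 𝟙 (hasDown? f j v)) fe≢fe′))
            (ℕₚ.m≤n+m (colours v) (𝟙 (v ≟ root)))
          ... | no _ with down-or-root v
          ...   | inj₁ v≡root = ℕₚ.≤-trans
            (ℕₚ.≤-reflexive (sym (𝟙-yes (v ≟ root) v≡root))) (ℕₚ.m≤m+n _ (colours v))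
          ...   | inj₂ (e , d) = ℕₚ.≤-trans
            (subst (_≤ colours v) (has-colour d) (term≤sum (λ j → 𝟙 (hasDown? f j v)) (f e)))
            (ℕₚ.m≤n+m (colours v) (𝟙 (v ≟ root)))
          bound : n + count (bichromatic? f) ≤ 1 + r * ∣ colourClass f i ∩ tree ∣
          bound = begin
            n + count (bichromatic? f)
              ≡⟨ cong (_+ count (bichromatic? f)) (trans (sum-const n 1) (ℕₚ.*-identityʳ n)) ⟨
            sum {n} (λ _ → 1) + count (bichromatic? f)
              ≡⟨ ∑-distrib-+ (λ _ → 1) (λ v → 𝟙 (bichromatic? f v)) ⟨
            sum (λ v → 1 + 𝟙 (bichromatic? f v))
              ≤⟨ sum-mono-≤ local ⟩
            sum (λ v → 𝟙 (v ≟ root) + colours v)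
              ≡⟨ ∑-distrib-+ (λ v → 𝟙 (v ≟ root)) colours ⟩
            count (_≟ root) + sum colours
              ≤⟨ ℕₚ.+-mono-≤ (count-unique≤1 (_≟ root) (λ _ _ p q → trans p (sym q)))
                   (ℕₚ.≤-reflexive (∑-comm (λ v j → 𝟙 (hasDown? f j v)))) ⟩
            1 + sum (λ j → count (hasDown? f j))
              ≤⟨ ℕₚ.+-monoʳ-≤ 1 (ℕₚ.≤-trans heavy (ℕₚ.*-monoʳ-≤ r count≤tree)) ⟩
            1 + r * ∣ colourClass f i ∩ tree ∣ ∎

  -- Connected components, the size of forests, and deciding what is a spanning tree.

  length-filter-tabulate : ∀ {A : Set} {P : A → Set} (P? : ∀ x → Dec (P x)) {m} (f : Fin m → A) →
                           length (filter P? (List.tabulate f)) ≡ count (P? ∘ f)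
  length-filter-tabulate P? {zero}  f = refl
  length-filter-tabulate P? {suc m} f with P? (f zero)
  ... | yes _ = cong suc (length-filter-tabulate P? (f ∘ suc))
  ... | no _  = length-filter-tabulate P? (f ∘ suc)

  module Components {n : ℕ} (G : Graph n) where
    open Graph G
    open GraphProperties G

    -- Union–find: a label is a representative of its component.
    label : List Edge → Fin n → Fin n
    label []       v = v
    label (e ∷ es) v with label es v ≟ label es (proj₁ (ends e))
    ... | yes _ = label es (proj₂ (ends e))
    ... | no _  = label es v

    Connection : List Edge → Fin n → Fin n → Set
    Connection es = Star (Connects (_∈ₗ es))

    weaken : ∀ {e es u v} → Connection es u v → Connection (e ∷ es) u v
    weaken = Star.map λ (e , e∈ , j) → e , there e∈ , j

    label-sound : ∀ es {u v} → label es u ≡ label es v → Connection es u v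
    label-sound []       refl = ε
    label-sound (e ∷ es) {u} {v} eq
      with label es u ≟ label es (proj₁ (ends e)) | label es v ≟ label es (proj₁ (ends e))
    ... | yes p | yes q = weaken (label-sound es (trans p (sym q)))
    ... | yes p | no _  = weaken (label-sound es p) ◅◅
                          (e , here refl , inj₁ refl) ◅ weaken (label-sound es eq)
    ... | no _  | yes q = weaken (label-sound es eq) ◅◅
                          (e , here refl , inj₂ refl) ◅ weaken (label-sound es (sym q))
    ... | no _  | no _  = weaken (label-sound es eq)

    label-∷ : ∀ e es {u v} → label es u ≡ label es v → label (e ∷ es) u ≡ label (e ∷ es) v
    label-∷ e es {u} {v} eq
      with label es u ≟ label es (proj₁ (ends e)) | label es v ≟ label es (proj₁ (ends e))
    ... | yes _ | yes _ = refl
    ... | yes p | no ¬q = contradiction (trans (sym eq) p) ¬q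
    ... | no ¬p | yes q = contradiction (trans eq q) ¬p
    ... | no _  | no _  = eq

    label-ends : ∀ {e es} → e ∈ₗ es → label es (proj₁ (ends e)) ≡ label es (proj₂ (ends e))
    label-ends {e} {_ ∷ es} (there e∈) = label-∷ _ es (label-ends e∈)
    label-ends {e} {_ ∷ es} (here refl)
      with label es (proj₁ (ends e)) ≟ label es (proj₁ (ends e))
         | label es (proj₂ (ends e)) ≟ label es (proj₁ (ends e))
    ... | yes _ | yes _ = refl
    ... | yes _ | no _  = refl
    ... | no ¬p | _     = contradiction refl ¬p

    label-complete : ∀ {es u v} → Connection es u v → label es u ≡ label es v
    label-complete ε = refl
    label-complete {es} ((e , e∈ , inj₁ eq) ◅ p) = trans
      (subst (λ x → label es (proj₁ x) ≡ label es (proj₂ x)) eq (label-ends e∈)) (label-complete p)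
    label-complete {es} ((e , e∈ , inj₂ eq) ◅ p) = trans
      (sym (subst (λ x → label es (proj₁ x) ≡ label es (proj₂ x)) eq (label-ends e∈))) (label-complete p)

    SimplePath : (Edge → Set) → Fin n → Fin n → Set
    SimplePath P u v = ∃[ vs ] Unique (u ∷ vs) × Linked (Connects P) (u ∷ vs) × final u vs ≡ v

    -- Loop removal: if the vertex to be prepended already lies on the path, only the part from its
    -- occurrence on is kept.
    suffix : ∀ {P u v} w vs → u ∈ₗ w ∷ vs → Unique (w ∷ vs) → Linked (Connects P) (w ∷ vs) →
             final w vs ≡ v → SimplePath P u v
    suffix w vs       (here refl) un       li       eq = vs , un , li , eq
    suffix w (x ∷ vs) (there u∈)  (_ ∷ un) (_ ∷ li) eq = suffix x vs u∈ un li eq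

    simplify : ∀ {P u v} → Star (Connects P) u v → SimplePath P u v
    simplify ε = [] , [] ∷ [] , [-] , refl
    simplify {u = u} (_◅_ {j = w} uw p) with simplify p
    ... | vs , un , li , eq with Any.any? (u ≟_) (w ∷ vs)
    ...   | yes u∈ = suffix w vs u∈ un li eq
    ...   | no u∉  = w ∷ vs , Allₚ.¬Any⇒All¬ (w ∷ vs) u∉ ∷ un , uw ∷ li , eq

    -- Take a simple path along `P` from `u` to `v`. It is not empty, as there are no loops, and not
    -- a single edge, as this edge would be `e` itself. So it has at least three vertices, and `e`
    -- closes it.
    closing-edge-cycle : ∀ {P : Edge → Set} {T e u v} → (∀ {e} → P e → e ∈ T) → e ∈ T → ¬ P e →
                         Joins e u v → Star (Connects P) u v → Cycle T
    closing-edge-cycle {u = u} P⊆T e∈T ¬Pe j path with simplify path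
    ... | [] , _ , _ , refl = contradiction j joins-distinct
    ... | _ ∷ [] , _ , (e′ , Pe′ , j′) ∷ [-] , refl with refl ← joins-unique j j′ = contradiction Pe′ ¬Pe
    ... | vs@(_ ∷ _ ∷ _) , un , li , refl =
      u , vs , s≤s (s≤s z≤n) , un ,
      linked-∷ʳ vs (Linked.map (λ (e , Pe , j) → e , P⊆T Pe , j) li) (_ , e∈T , swap j)

    module _ {T : EdgeSet} (acyclic : ¬ Cycle T)
             {S : Fin n → Set} (S? : ∀ v → Dec (S v)) where

      Root : List Edge → Fin n → Set
      Root es v = S v × label es v ≡ v

      root? : ∀ es v → Dec (Root es v)
      root? es v = S? v ×-dec (label es v ≟ v)

      Inside : Edge → Set
      Inside e = e ∈ T × S (proj₁ (ends e)) × S (proj₂ (ends e))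

      label-in : ∀ {es} → All Inside es → ∀ {v} → S v → S (label es v)
      label-in []                           s = s
      label-in {e ∷ es} ((_ , _ , t) ∷ ins) {v} s with label es v ≟ label es (proj₁ (ends e))
      ... | yes _ = label-in ins t
      ... | no _  = label-in ins s

      -- Equal labels mean that the other edges already connect the ends of `e`, which would then
      -- close a cycle in `T`.
      label-split : ∀ {e es} → All Inside (e ∷ es) → Unique (e ∷ es) →
                    label es (proj₁ (ends e)) ≢ label es (proj₂ (ends e))
      label-split {e} {es} ((e∈T , _) ∷ ins) (e∉ ∷ _) eq = acyclic
        (closing-edge-cycle (λ e′∈ → proj₁ (All.lookup ins e′∈)) e∈T (λ e∈ → All.lookup e∉ e∈ refl)
          (inj₁ refl) (label-sound es eq))

      label-idem : ∀ {es} → All Inside es → Unique es → ∀ v → label es (label es v) ≡ label es v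
      label-idem {[]}     _ _ v = refl
      label-idem {e ∷ es} ins@(_ ∷ ins′) un@(_ ∷ un′) v
        with label es v ≟ label es (proj₁ (ends e))
      ... | no ¬p with label es (label es v) ≟ label es (proj₁ (ends e))
      ...   | yes q = contradiction (trans (sym (label-idem ins′ un′ v)) q) ¬p
      ...   | no _  = label-idem ins′ un′ v
      label-idem {e ∷ es} ins@(_ ∷ ins′) un@(_ ∷ un′) v
          | yes p with label es (label es (proj₂ (ends e))) ≟ label es (proj₁ (ends e))
      ...   | yes _ = refl
      ...   | no _  = label-idem ins′ un′ _

      -- Inserting e merges two components, so the root of one of them is lost.
      length+roots : ∀ {es} → All Inside es → Unique es → length es + count (root? es) ≤ count S?
      length+roots {[]} _ _ = sum-mono-≤ λ v → 𝟙-mono (root? [] v)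
        λ (s , _) → ℕₚ.≤-reflexive (sym (𝟙-yes (S? v) s))
      length+roots {e ∷ es} ins@((_ , s , _) ∷ ins′) un@(_ ∷ un′) = begin
        suc (length es) + count (root? (e ∷ es))  ≡⟨ ℕₚ.+-suc (length es) _ ⟨
        length es + suc (count (root? (e ∷ es)))  ≤⟨ ℕₚ.+-monoʳ-≤ (length es) fewer ⟩
        length es + count (root? es)              ≤⟨ length+roots ins′ un′ ⟩
        count S?                                  ∎
        where
        open ℕₚ.≤-Reasoning
        a = label es (proj₁ (ends e))
        still-root : ∀ v → label (e ∷ es) v ≡ v → label es v ≡ v × v ≢ a
        still-root v eq with label es v ≟ a
        -- A relabelled vertex gets the root of the other component. Were it that root itself, the
        -- two components would have had the same label before.
        ... | yes p = contradiction (trans (sym p)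
                        (trans (cong (label es) (sym eq)) (label-idem ins′ un′ _))) (label-split ins un)
        ... | no ¬p = eq , λ { refl → ¬p (label-idem ins′ un′ _) }
        root-a : Root es a
        root-a = label-in ins′ s , label-idem ins′ un′ _
        fewer : count (root? (e ∷ es)) < count (root? es)
        fewer = sum-mono-<
          (λ v → 𝟙-mono (root? (e ∷ es) v) λ (s , eq) →
            ℕₚ.≤-reflexive (sym (𝟙-yes (root? es v) (s , proj₁ (still-root v eq)))))
          a
          (subst₂ _<_ (sym (𝟙-no (root? (e ∷ es) a) λ (_ , eq) → proj₂ (still-root a eq) refl))
                      (sym (𝟙-yes (root? es a) root-a)) (s≤s z≤n))

      forest-bound : ∀ F → (∀ {e} → e ∈ F → Inside e) → ∣ F ∣ ≤ count S?
      forest-bound F F-inside = begin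
        ∣ F ∣                          ≡⟨ ∣∣≡count F ⟩
        count (_∈? F)                  ≡⟨ length-filter-tabulate (_∈? F) id ⟨
        length es                      ≤⟨ ℕₚ.m≤m+n _ _ ⟩
        length es + count (root? es)   ≤⟨ length+roots
                                            (All.tabulate (F-inside ∘ proj₂ ∘ ∈-filter⁻ (_∈? F) {xs = allFin #E}))
                                            (Uniqueₚ.filter⁺ (_∈? F) (Uniqueₚ.allFin⁺ #E)) ⟩
        count S?                       ∎
        where
        open ℕₚ.≤-Reasoning
        es = filter (_∈? F) (allFin #E)

    -- Once all edges of `T` are inserted, connectivity says that all labels agree.
    connected? : ∀ T → Dec (Connected T)
    connected? T = Dec.map′
      (λ eq u v → Star.map (λ (e , e∈ , j) → e , proj₂ (∈-filter⁻ (_∈? T) {xs = allFin #E} e∈) , j)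
                    (label-sound es (eq u v)))
      (λ con u v → label-complete
        (Star.map (λ (e , e∈ , j) → e , ∈-filter⁺ (_∈? T) (∈-allFin e) e∈ , j) (con u v)))
      (all? λ u → all? λ v → label es u ≟ label es v)
      where es = filter (_∈? T) (allFin #E)

    list≤? : ∀ m {P : List (Fin n) → Set} → (∀ xs → Dec (P xs)) →
             Dec (∃[ xs ] length xs ≤ m × P xs)
    list≤? zero P? = Dec.map′ (λ p → [] , z≤n , p) (λ { ([] , _ , p) → p }) (P? [])
    list≤? (suc m) P? = Dec.map′
      [ (λ p → [] , z≤n , p) , (λ (x , xs , le , p) → x ∷ xs , s≤s le , p) ]′
      (λ { ([] , _ , p) → inj₁ p ; (x ∷ xs , s≤s le , p) → inj₂ (x , xs , le , p) })
      (P? [] ⊎-dec any? λ x → list≤? m (P? ∘ (x ∷_)))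

    -- The vertices of a cycle are distinct, so a search through lists of length at most `n` is
    -- exhaustive.
    cycle? : ∀ T → Dec (Cycle T)
    cycle? T = Dec.map′ (λ (x , xs , _ , c) → x , xs , c)
      (λ { (x , xs , c@(_ , (_ ∷ un) , _)) → x , xs , Finₚ.injective⇒≤ (lookup-injective un) , c })
      (any? λ x → list≤? n λ xs →
        (2 ℕₚ.≤? length xs) ×-dec allPairs? (λ u v → ¬? (u ≟ v)) (x ∷ xs)
          ×-dec Linked.linked? link? ((x ∷ xs) ∷ʳ x))
      where
      link? : ∀ u v → Dec (Link T u v)
      link? u v = any? λ e → (e ∈? T) ×-dec joins? e u v

    spanningTree? : ∀ T → Dec (SpanningTree T)
    spanningTree? T = connected? T ×-dec ¬? (cycle? T)

  -- Existence of the maximum over trees and of the minimum over colourings.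

  decode : ∀ {m} → Fin (2 ^ m) → Subset m
  decode j = Vec.tabulate (λ e → does (finToFun j e ≟ suc zero))

  decode-surjective : ∀ {m} (T : Subset m) → ∃[ j ] decode j ≡ T
  decode-surjective T = funToFin bits , trans
    (Vecₚ.tabulate-cong λ e → trans (cong (λ b → does (b ≟ suc zero)) (Finₚ.finToFun-funToFin bits e))
                                    (bit (Vec.lookup T e)))
    (Vecₚ.tabulate∘lookup T)
    where
    bits : _ → Fin 2
    bits e = if Vec.lookup T e then suc zero else zero
    bit : ∀ b → does ((if b then suc zero else zero {1}) ≟ suc zero) ≡ b
    bit true  = refl
    bit false = refl

  subset-argmax : ∀ {m} {P : Subset m → Set} → (∀ T → Dec (P T)) → (h : Subset m → ℚ) →
                  ∃[ T ] P T → ∃[ T ] P T × (∀ T′ → P T′ → h T′ ℚ.≤ h T)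
  subset-argmax {P = P} P? h (T , p) with decode-surjective T
  ... | j , refl with extremum {_≼_ = ℚ._≤_} ℚₚ.≤-refl ℚₚ.≤-trans ℚₚ.≤-total
                        (P? ∘ decode) (h ∘ decode) (j , p)
  ...   | i , q , i-max = decode i , q , λ T′ q′ → let j′ , eq = decode-surjective T′ in
            subst (λ T′ → h T′ ℚ.≤ h (decode i)) eq (i-max j′ (subst P (sym eq) q′))

  -- Colourings are enumerated through `finToFun`, which recovers a given function only pointwise.
  -- Therefore the minimum is compared with a pointwise equal copy `f″` of each competitor.
  colouring-argmin : ∀ {m r} .{{_ : NonZero r}} (h : (Fin m → Fin r) → ℚ) →
                     ∃[ f ] (∀ f′ → ∃[ f″ ] (∀ e → f″ e ≡ f′ e) × h f ℚ.≤ h f″)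
  colouring-argmin {m} {r} h
    with extremum {_≼_ = ℚ._≥_} ℚₚ.≤-refl (λ p q → ℚₚ.≤-trans q p) (λ x y → ℚₚ.≤-total y x)
           (λ _ → yes tt) (h ∘ finToFun) (funToFin {m} (λ _ → Fin.fromℕ< (ℕ.>-nonZero⁻¹ r)) , tt)
  ... | j , _ , j-min = finToFun j ,
        λ f′ → finToFun (funToFin f′) , Finₚ.finToFun-funToFin f′ , j-min (funToFin f′) tt

  module Extremes {n : ℕ} (G : Graph n) {r : ℕ} .{{_ : NonZero r}}
                  (spanned : ∃[ T ] Graph.SpanningTree G T) where
    open Graph G
    open Components G using (spanningTree?)

    max-exists : ∀ (f : Colouring r) → ∃[ M ] IsMaxDiscrepancy G f M
    max-exists f =
      let T , st , T-max = subset-argmax spanningTree? (treeDiscrepancy f) spanned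
      in treeDiscrepancy f T , (T , st , refl) , λ { _ (T′ , st′ , refl) → T-max T′ st′ }

    treeDiscrepancy-cong : ∀ {f f′ : Colouring r} → (∀ e → f e ≡ f′ e) →
                           ∀ T → treeDiscrepancy f T ≡ treeDiscrepancy f′ T
    treeDiscrepancy-cong f≗f′ T =
      cong (λ L → (ℤ.+ r ℚ./ 1) ℚ.* ((ℤ.+ max 0 L ℚ./ 1) ℚ.- ((ℤ.+ n ℤ.- ℤ.1ℤ) ℚ./ r)))
        (Listₚ.tabulate-cong λ i → cong (λ C → ∣ C ∩ T ∣)
          (Vecₚ.tabulate-cong λ e → cong (λ c → does (c ≟ i)) (f≗f′ e)))

    discrepancy-exists : ∃[ D ] IsDiscrepancy G r D
    discrepancy-exists =
      let f , f-min = colouring-argmin (proj₁ ∘ max-exists)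
      in proj₁ (max-exists f) , (f , proj₂ (max-exists f)) , λ M (f′ , _ , M-max) →
        let f″ , f″≗f′ , le = f-min f′
            _ , (T , st , M″≡) , _ = max-exists f″
        -- `M` bounds the discrepancy under `f′` of the tree that is best for `f″`, and this equals
        -- its discrepancy under `f″`.
        in ℚₚ.≤-trans le (M-max _ (T , st , trans M″≡ (treeDiscrepancy-cong f″≗f′ T)))

  -- Axis-parallel walks in the lattice and their average cost.

  line-walk : ∀ {k} (R : Fin k → Set) →
              (∀ x y → ∣ toℕ x - toℕ y ∣ ≡ 1 → R x → R y) → ∀ x y → R x → R y
  line-walk R next zero zero r = r
  line-walk {suc (suc k)} R next zero (suc y) r =
    line-walk (R ∘ suc) (λ x y → next (suc x) (suc y)) zero y (next zero (suc zero) refl r)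
  line-walk {suc (suc k)} R next (suc x) zero r =
    next (suc zero) zero refl (line-walk (R ∘ suc) (λ x y → next (suc x) (suc y)) x zero r)
  line-walk R next (suc x) (suc y) r =
    line-walk (R ∘ suc) (λ x y → next (suc x) (suc y)) x y r

  sum≡0⇒≡0 : ∀ {n} (f : Fin n → ℕ) → sum f ≡ 0 → ∀ i → f i ≡ 0
  sum≡0⇒≡0 f eq i = ℕₚ.n≤0⇒n≡0 (subst (f i ≤_) eq (term≤sum f i))

  module Lattice (k : ℕ) where

    head : ∀ d → Fin (k ^ suc d) → Fin k
    head d = quotient (k ^ d)

    tail : ∀ d → Fin (k ^ suc d) → Fin (k ^ d)
    tail d = remainder {k} (k ^ d)

    cons : ∀ d → Fin k → Fin (k ^ d) → Fin (k ^ suc d)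
    cons d = combine

    head-cons : ∀ d (x : Fin k) t → head d (cons d x t) ≡ x
    head-cons d x t = cong proj₁ (Finₚ.remQuot-combine x t)

    tail-cons : ∀ d (x : Fin k) t → tail d (cons d x t) ≡ t
    tail-cons d x t = cong proj₂ (Finₚ.remQuot-combine x t)

    cons-head-tail : ∀ d (u : Fin (k ^ suc d)) → cons d (head d u) (tail d u) ≡ u
    cons-head-tail d u = Finₚ.combine-remQuot {k} (k ^ d) u

    Neighbours : ∀ d → Fin (k ^ d) → Fin (k ^ d) → Set
    Neighbours d u v = GridAdj {k} {d} (finToFun u) (finToFun v)

    neighbours-head : ∀ d {x y : Fin k} t → ∣ toℕ x - toℕ y ∣ ≡ 1 →
                      Neighbours (suc d) (cons d x t) (cons d y t)
    neighbours-head d {x} {y} t xy = zero ,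
      trans (cong₂ (λ a b → ∣ toℕ a - toℕ b ∣) (head-cons d x t) (head-cons d y t)) xy ,
      λ { zero 0≢0 → contradiction refl 0≢0
        ; (suc j) _ → cong (λ t → finToFun t j) (trans (tail-cons d x t) (sym (tail-cons d y t))) }

    neighbours-tail : ∀ d (x : Fin k) {s t} → Neighbours d s t →
                      Neighbours (suc d) (cons d x s) (cons d x t)
    neighbours-tail d x {s} {t} (i , st , eq) = suc i ,
      trans (cong₂ (λ a b → ∣ toℕ (finToFun a i) - toℕ (finToFun b i) ∣) (tail-cons d x s) (tail-cons d x t)) st ,
      λ { zero _ → trans (head-cons d x s) (sym (head-cons d x t))
        ; (suc j) j≢ → trans (cong (λ s → finToFun s j) (tail-cons d x s))
            (trans (eq j (j≢ ∘ cong suc)) (cong (λ t → finToFun t j) (sym (tail-cons d x t)))) }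

    -- The sum of g over a walk from v to u, weakened to a sum over the d full lines
    -- that the walk follows; it corrects one coordinate at a time, starting with the first.
    cost : ∀ d → (Fin (k ^ d) → ℕ) → Fin (k ^ d) → Fin (k ^ d) → ℕ
    cost zero    g u v = g u
    cost (suc d) g u v =
      sum (λ x → g (cons d x (tail d v))) + cost d (g ∘ cons d (head d u)) (tail d u) (tail d v)

    cost-cons : ∀ d g (x : Fin k) u y v →
      cost (suc d) g (cons d x u) (cons d y v) ≡ sum (λ z → g (cons d z v)) + cost d (g ∘ cons d x) u v
    cost-cons d g x u y v
      rewrite head-cons d x u | tail-cons d x u | tail-cons d y v = refl

    -- Summed over all `v`, the lines of the first axis count each value of `g` exactly `k` times,
    -- which gives `k * sum g`. The remaining cost lies in the slice of the centre and occurs `k`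
    -- times; choosing a slice of at most average weight bounds it by the induction hypothesis with
    -- `sum g` in place of `k` times the weight of the slice.
    cheap-centre : .{{_ : NonZero k}} → ∀ d (g : Fin (k ^ d) → ℕ) →
                   ∃[ u ] sum (cost d g u) ≤ (d * k + 1) * sum g
    cheap-centre zero g = zero , ℕₚ.≤-reflexive (sym (ℕₚ.*-identityˡ (sum g)))
    cheap-centre (suc d) g
      with x , light ← below-average (λ x → sum (g ∘ cons d x))
      with u , cheap ← cheap-centre d (g ∘ cons d x) = cons d x u , bound
      where
      open ℕₚ.≤-Reasoning
      total : sum g ≡ sum (λ y → sum (g ∘ cons d y))
      total = sum-combine k g
      bound : sum (cost (suc d) g (cons d x u)) ≤ (suc d * k + 1) * sum g
      bound = begin
        sum (cost (suc d) g (cons d x u))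
          ≡⟨ sum-combine k (cost (suc d) g (cons d x u)) ⟩
        sum {k} (λ y → sum (λ v → cost (suc d) g (cons d x u) (cons d y v)))
          ≡⟨ sum-cong-≗ {k} (λ y → sum-cong-≗ (cost-cons d g x u y)) ⟩
        sum {k} (λ y → sum (λ v → sum (λ z → g (cons d z v)) + cost d (g ∘ cons d x) u v))
          ≡⟨ sum-const k _ ⟩
        k * sum (λ v → sum (λ z → g (cons d z v)) + cost d (g ∘ cons d x) u v)
          ≡⟨ cong (k *_) (∑-distrib-+ (λ v → sum (λ z → g (cons d z v))) (cost d (g ∘ cons d x) u)) ⟩
        k * (sum (λ v → sum (λ z → g (cons d z v))) + sum (cost d (g ∘ cons d x) u))
          ≡⟨ cong (λ s → k * (s + sum (cost d (g ∘ cons d x) u))) (trans (∑-comm (λ v z → g (cons d z v))) (sym total)) ⟩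
        k * (sum g + sum (cost d (g ∘ cons d x) u))
          ≤⟨ ℕₚ.*-monoʳ-≤ k (ℕₚ.+-monoʳ-≤ (sum g) cheap) ⟩
        k * (sum g + (d * k + 1) * sum (g ∘ cons d x))
          ≡⟨ rearrange k (sum g) (d * k + 1) (sum (g ∘ cons d x)) ⟩
        k * sum g + (d * k + 1) * (k * sum (g ∘ cons d x))
          ≤⟨ ℕₚ.+-monoʳ-≤ (k * sum g) (ℕₚ.*-monoʳ-≤ (d * k + 1)
               (ℕₚ.≤-trans light (ℕₚ.≤-reflexive (sym total)))) ⟩
        k * sum g + (d * k + 1) * sum g
          ≡⟨ collect k (d * k) (sum g) ⟩
        (suc d * k + 1) * sum g ∎
        where
        rearrange : ∀ k s c t → k * (s + c * t) ≡ k * s + c * (k * t)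
        rearrange = solve-∀
        collect : ∀ k e s → k * s + (e + 1) * s ≡ (k + e + 1) * s
        collect = solve-∀

    free⇒centre-free : ∀ d g (u v : Fin (k ^ d)) → cost d g u v ≡ 0 → g u ≡ 0
    free⇒centre-free zero    g u v eq = eq
    free⇒centre-free (suc d) g u v eq = subst (λ u → g u ≡ 0) (cons-head-tail d u)
      (free⇒centre-free d (g ∘ cons d (head d u)) (tail d u) (tail d v) (ℕₚ.m+n≡0⇒n≡0 _ eq))

    -- The walk is traversed backwards: from `u` inside its slice, by induction, and then along the
    -- line of the first axis through `v`. At cost zero every vertex entered has weight zero.
    free-walk : ∀ d (Q : Fin (k ^ d) → Set) g →
                (∀ v w → Neighbours d v w → g w ≡ 0 → Q v → Q w) →
                ∀ u v → cost d g u v ≡ 0 → Q u → Q v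
    free-walk zero    Q g next zero zero eq q = q
    free-walk (suc d) Q g next u v eq q = subst Q (cons-head-tail d v)
      (line-walk (λ x → Q (cons d x (tail d v)))
        (λ x y xy → next _ _ (neighbours-head d (tail d v) xy)
                      (sum≡0⇒≡0 (λ x → g (cons d x (tail d v))) (ℕₚ.m+n≡0⇒m≡0 _ eq) y))
        (head d u) (head d v)
        (free-walk d (Q ∘ cons d (head d u)) (g ∘ cons d (head d u))
          (λ s t st → next _ _ (neighbours-tail d (head d u) st))
          (tail d u) (tail d v) (ℕₚ.m+n≡0⇒n≡0 _ eq) (subst Q (sym (cons-head-tail d u)) q)))

  -- Steps and distances along one axis.

  ∣1+n-n∣≡1 : ∀ n → ∣ suc n - n ∣ ≡ 1
  ∣1+n-n∣≡1 zero    = refl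
  ∣1+n-n∣≡1 (suc n) = ∣1+n-n∣≡1 n

  ∣-∣≡1 : ∀ x y → ∣ x - y ∣ ≡ 1 → x ≡ suc y ⊎ y ≡ suc x
  ∣-∣≡1 zero    y       eq = inj₂ eq
  ∣-∣≡1 (suc x) zero    eq = inj₁ eq
  ∣-∣≡1 (suc x) (suc y) eq with ∣-∣≡1 x y eq
  ... | inj₁ p = inj₁ (cong suc p)
  ... | inj₂ p = inj₂ (cong suc p)

  closer-up : ∀ {x c} → x < c → ∣ suc x - c ∣ < ∣ x - c ∣
  closer-up {zero}  {suc c} _         = ℕₚ.≤-refl
  closer-up {suc x} {suc c} (s≤s x<c) = closer-up x<c

  closer-down : ∀ {x c} → c ≤ x → ∣ x - c ∣ < ∣ suc x - c ∣
  closer-down {x} {zero}      _         = s≤s (ℕₚ.≤-reflexive (ℕₚ.∣-∣-identityʳ x))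
  closer-down {suc x} {suc c} (s≤s c≤x) = closer-down c≤x

  toward : ∀ {k} {x c : Fin k} → x ≢ c →
           ∃[ y ] ∣ toℕ x - toℕ y ∣ ≡ 1 × ∣ toℕ y - toℕ c ∣ < ∣ toℕ x - toℕ c ∣
  toward {x = x} {c} x≢c with Finₚ.<-cmp x c
  ... | tri≈ _ x≡c _ = contradiction x≡c x≢c
  ... | tri< x<c _ _ = y , trans (cong (∣ toℕ x -_∣) y≡) (trans (ℕₚ.∣-∣-comm (toℕ x) _) (∣1+n-n∣≡1 (toℕ x))) ,
                       subst (λ y → ∣ y - toℕ c ∣ < ∣ toℕ x - toℕ c ∣) (sym y≡) (closer-up x<c)
    where
    y  = Fin.fromℕ< (ℕₚ.≤-<-trans x<c (Finₚ.toℕ<n c))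
    y≡ = Finₚ.toℕ-fromℕ< (ℕₚ.≤-<-trans x<c (Finₚ.toℕ<n c))
  toward {x = suc x} {c} x≢c | tri> _ _ (s≤s c≤x) = Fin.inject₁ x ,
    trans (cong (∣ suc (toℕ x) -_∣) (Finₚ.toℕ-inject₁ x)) (∣1+n-n∣≡1 (toℕ x)) ,
    subst (λ y → ∣ y - toℕ c ∣ < ∣ suc (toℕ x) - toℕ c ∣) (sym (Finₚ.toℕ-inject₁ x)) (closer-down c≤x)

  neighbour : ∀ {m} (x : Fin (2 + m)) → Σ (Fin (2 + m)) λ y → ∣ toℕ x - toℕ y ∣ ≡ 1
  neighbour zero    = suc zero , refl
  neighbour (suc x) = let y , eq , _ = toward {x = suc x} {zero} λ () in y , eq

  end : ∀ {m} → Fin 2 → Fin (suc m)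
  end zero    = zero
  end (suc _) = fromℕ _

  -- A step down approaches position 0, a step up the last position.
  end-ahead : ∀ {m} (x y : Fin (suc m)) → ∣ toℕ x - toℕ y ∣ ≡ 1 →
              ∃[ s ] ∣ toℕ y - toℕ (end {m} s) ∣ < ∣ toℕ x - toℕ (end {m} s) ∣
  end-ahead {m} x y eq with ∣-∣≡1 (toℕ x) (toℕ y) eq
  ... | inj₁ x≡1+y = zero , subst (λ x → ∣ toℕ y - 0 ∣ < ∣ x - 0 ∣) (sym x≡1+y) (closer-down z≤n)
  ... | inj₂ y≡1+x = suc zero , subst₂ (λ y c → ∣ y - c ∣ < ∣ toℕ x - c ∣) (sym y≡1+x) (sym (Finₚ.toℕ-fromℕ m))
    (closer-up (subst (_≤ m) y≡1+x (Finₚ.toℕ≤pred[n] y)))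

  finToFun-injective : ∀ {k} d {u v : Fin (k ^ d)} → (∀ a → finToFun {k} {d} u a ≡ finToFun v a) → u ≡ v
  finToFun-injective zero    {zero} {zero} _ = refl
  finToFun-injective {k} (suc d) {u} {v} eq =
    trans (sym (cons-head-tail d u))
    (trans (cong₂ (cons d) (eq zero) (finToFun-injective d (eq ∘ suc))) (cons-head-tail d v))
    where open Lattice k

  another : ∀ {d} → 2 ≤ d → (a : Fin d) → ∃[ b ] b ≢ a
  another (s≤s (s≤s _)) zero    = suc zero , λ ()
  another (s≤s (s≤s _)) (suc a) = zero , λ ()

  -- Pure and impure vertices of a coloured grid.

  module GridColouring (m d : ℕ) (2≤d : 2 ≤ d) where
    k : ℕ
    k = 2 + m

    open Lattice k
    open Graph (grid k d)
    open GraphProperties (grid k d)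

    Vertex : Set
    Vertex = Fin (k ^ d)

    _at_ : Vertex → Fin d → Fin k
    v at a = finToFun v a

    distance : Vertex → Vertex → ℕ
    distance c v = sum (λ a → ∣ toℕ (v at a) - toℕ (c at a) ∣)

    shift : Vertex → Fin d → Fin k → Vertex
    shift v a y = funToFin (updateAt (v at_) a (λ _ → y))

    shift-same : ∀ v a y → shift v a y at a ≡ y
    shift-same v a y = trans (Finₚ.finToFun-funToFin _ a) (VecFₚ.updateAt-updates a (v at_))

    shift-other : ∀ v a y j → j ≢ a → v at j ≡ shift v a y at j
    shift-other v a y j j≢a = sym (trans (Finₚ.finToFun-funToFin _ j) (VecFₚ.updateAt-minimal j a (v at_) j≢a))

    shift-neighbours : ∀ {v a y} → ∣ toℕ (v at a) - toℕ y ∣ ≡ 1 → Neighbours d v (shift v a y)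
    shift-neighbours {v} {a} {y} eq = a ,
      trans (cong (λ z → ∣ toℕ (v at a) - toℕ z ∣) (shift-same v a y)) eq , shift-other v a y

    closer : ∀ {c v w a} → (∀ j → j ≢ a → v at j ≡ w at j) →
             ∣ toℕ (w at a) - toℕ (c at a) ∣ < ∣ toℕ (v at a) - toℕ (c at a) ∣ →
             distance c w < distance c v
    closer {c} {v} {w} {a} same lt = sum-mono-< termwise a lt
      where
      termwise : ∀ j → ∣ toℕ (w at j) - toℕ (c at j) ∣ ≤ ∣ toℕ (v at j) - toℕ (c at j) ∣
      termwise j with j ≟ a
      ... | yes refl = ℕₚ.<⇒≤ lt
      ... | no j≢a   = ℕₚ.≤-reflexive (cong (λ x → ∣ toℕ x - toℕ (c at j) ∣) (sym (same j j≢a)))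

    -- In a coordinate where `v` differs from `c`, one step toward `c` shortens the distance.
    down-or-root : ∀ c v → v ≡ c ⊎ ∃[ e ] Down (distance c) v e
    down-or-root c v with any? (λ a → ¬? (v at a ≟ c at a))
    ... | no same = inj₁ (finToFun-injective {k} d λ a →
                      decidable-stable (v at a ≟ c at a) λ v≢c → same (a , v≢c))
    ... | yes (a , v≢c) =
      let y , vy , lt = toward v≢c
          w = shift v a y
          e , j = adj⇒edge {v} {w} (shift-neighbours vy)
      in inj₂ (e , w , j , closer (shift-other v a y)
           (subst (λ z → ∣ toℕ z - toℕ (c at a) ∣ < ∣ toℕ (v at a) - toℕ (c at a) ∣) (sym (shift-same v a y)) lt))

    -- Corners are numbered by the codes of their sign vectors, so that sums over them and
    -- `pigeonhole` apply.
    corner : Fin (2 ^ d) → Vertex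
    corner σ = funToFin {d} {k} (λ a → end (finToFun {2} {d} σ a))

    corner-at : ∀ (s : Fin d → Fin 2) a → corner (funToFin {d} {2} s) at a ≡ end (s a)
    corner-at s a = trans (Finₚ.finToFun-funToFin {d} {k} (λ a → end (finToFun {2} {d} (funToFin s) a)) a) (cong end (Finₚ.finToFun-funToFin s a))

    module _ {r : ℕ} (f : Colouring r) where

      impurityAt : Fin (2 ^ d) → Vertex → ℕ
      impurityAt σ v = 𝟙 (bichromatic? (distance (corner σ)) f v)

      -- Counting the corners, rather than recording whether there is one, lets the total split by
      -- corners. The value 0 means that the vertex is pure.
      impurity : Vertex → ℕ
      impurity v = sum (λ σ → impurityAt σ v)

      -- Two edges at v along different axes point towards a common corner.
      pure-across : ∀ {v} → impurity v ≡ 0 → ∀ {e e′ w w′} → Joins e v w → Joins e′ v w′ →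
        ((a , _) : Neighbours d v w) ((b , _) : Neighbours d v w′) → a ≢ b → f e ≡ f e′
      pure-across {v} pure {e} {e′} {w} {w′} j j′ (a , vw , same) (b , vw′ , same′) a≢b =
        let s , s-ahead = end-ahead (v at a) (w at a) vw
            t , t-ahead = end-ahead (v at b) (w′ at b) vw′
            signs : Fin d → Fin 2
            signs = updateAt (λ _ → t) a (λ _ → s)
            σ = funToFin signs
            at-a = trans (corner-at signs a) (cong end (VecFₚ.updateAt-updates a (λ _ → t)))
            at-b = trans (corner-at signs b) (cong end (VecFₚ.updateAt-minimal b a (λ _ → t) (a≢b ∘ sym)))
            down  = w , j , closer {corner σ} same
              (subst (λ z → ∣ toℕ (w at a) - toℕ z ∣ < ∣ toℕ (v at a) - toℕ z ∣) (sym at-a) s-ahead)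
            down′ = w′ , j′ , closer {corner σ} same′
              (subst (λ z → ∣ toℕ (w′ at b) - toℕ z ∣ < ∣ toℕ (v at b) - toℕ z ∣) (sym at-b) t-ahead)
        in decidable-stable (f e ≟ f e′) λ fe≢fe′ →
             𝟙-≡0 (bichromatic? (distance (corner σ)) f v)
               (sum≡0⇒≡0 (λ σ → impurityAt σ v) pure σ) (e , e′ , down , down′ , fe≢fe′)

      -- Two edges along the same axis may point in opposite directions and approach no common
      -- corner. Both are then compared with an edge along a second axis; this is where `2 ≤ d`
      -- enters.
      pure⇒monochromatic : ∀ {v} → impurity v ≡ 0 → ∀ {e e′ w w′} →
                           Joins e v w → Joins e′ v w′ → f e ≡ f e′
      pure⇒monochromatic {v} pure {e} {e′} {w} {w′} j j′ =
        compare (edge⇒adj {e} {v} {w} j) (edge⇒adj {e′} {v} {w′} j′)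
        where
        compare : Neighbours d v w → Neighbours d v w′ → f e ≡ f e′
        compare vw@(a , _) vw′@(b , _) with a ≟ b
        ... | no a≢b   = pure-across pure j j′ vw vw′ a≢b
        ... | yes refl =
          let b′ , b′≢a = another 2≤d a
              y , vy = neighbour {m} (v at b′)
              vw″ = shift-neighbours {v} vy
              _ , j″ = adj⇒edge {v} {shift v b′ y} vw″
          in trans (pure-across pure j j″ vw vw″ (b′≢a ∘ sym)) (pure-across pure j″ j′ vw″ vw′ b′≢a)

      total-impurity : ℕ
      total-impurity = sum impurity

      module _ .{{_ : NonZero r}} where

        -- Some corner accounts for at least the average share of the total impurity; `x` is its
        -- number of bichromatic vertices, and its tree has the excess `x`.
        impure⇒biased : ∃[ i ] ∃[ T ] ∃[ x ] SpanningTree T × total-impurity ≤ 2 ^ d * x ×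
          k ^ d + x ≤ 1 + r * ∣ colourClass f i ∩ T ∣
        impure⇒biased =
          let instance _ = ℕₚ.m^n≢0 2 d
              σ , heavy = pigeonhole (λ σ → sum (impurityAt σ))
              i , T , st , le = bichromatic-excess (distance (corner σ)) (down-or-root (corner σ)) f
          in i , T , _ , st , ℕₚ.≤-trans (ℕₚ.≤-reflexive (∑-comm (λ v σ → impurityAt σ v))) heavy , le

      module Centre (u : Vertex) (cheap : sum (cost d impurity u) ≤ (d * k + 1) * total-impurity) where
        edge-at-u : ∃[ e ] ∃[ w ] Joins e u w
        edge-at-u =
          let a = Fin.fromℕ< (ℕₚ.<-≤-trans (s≤s z≤n) 2≤d)
              y , uy = neighbour {m} (u at a)
              e , j = adj⇒edge {u} {shift u a y} (shift-neighbours {u} uy)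
          in e , _ , j
        κ : Fin r
        κ = f (proj₁ edge-at-u)
        open TreeFavouring (distance u) (down-or-root u) f κ
        AllEdges : Vertex → Set
        AllEdges v = ∀ {e w} → Joins e v w → f e ≡ κ
        spread : ∀ v w → Neighbours d v w → impurity w ≡ 0 → AllEdges v → AllEdges w
        spread v w vw pure-w all-v j′ =
          let _ , j = adj⇒edge {v} {w} vw
          in trans (pure⇒monochromatic pure-w j′ (swap j)) (all-v j)
        -- The cost includes the impurity of `u`, so `u` is pure and all its edges have colour `κ`.
        -- Consecutive vertices of the walk share an edge, so by `spread` the colour passes from one
        -- pure vertex to the next.
        free⇒κ : ∀ v → cost d impurity u v ≡ 0 → AllEdges v
        free⇒κ v free = free-walk d AllEdges impurity spread u v free λ j →
          pure⇒monochromatic (free⇒centre-free d impurity u v free) j (proj₂ (proj₂ edge-at-u))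
        -- A vertex whose walk meets an impure line is written off: its cost, a positive integer,
        -- already pays for it.
        local : ∀ v → 1 ≤ 𝟙 (v ≟ u) + 𝟙 (hasDown? (distance u) f κ v) + cost d impurity u v
        local v = by-cost (cost d impurity u v) refl
          where
          by-cost : ∀ c → cost d impurity u v ≡ c → 1 ≤ 𝟙 (v ≟ u) + 𝟙 (hasDown? (distance u) f κ v) + c
          by-cost (suc c) _    = ℕₚ.≤-trans (s≤s z≤n) (ℕₚ.m≤n+m (suc c) _)
          by-cost zero    free = [ at-u , below ]′ (down-or-root u v)
            where
            at-u : v ≡ u → 1 ≤ 𝟙 (v ≟ u) + 𝟙 (hasDown? (distance u) f κ v) + 0
            at-u v≡u = ℕₚ.≤-trans (ℕₚ.≤-reflexive (sym (𝟙-yes (v ≟ u) v≡u)))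
                         (ℕₚ.≤-trans (ℕₚ.m≤m+n _ _) (ℕₚ.m≤m+n _ 0))
            below : ∃[ e ] Down (distance u) v e → 1 ≤ 𝟙 (v ≟ u) + 𝟙 (hasDown? (distance u) f κ v) + 0
            below (e , down) = ℕₚ.≤-trans
              (ℕₚ.≤-reflexive (sym (𝟙-yes (hasDown? (distance u) f κ v) (e , down , free⇒κ v free (proj₁ (proj₂ down))))))
              (ℕₚ.≤-trans (ℕₚ.m≤n+m _ (𝟙 (v ≟ u))) (ℕₚ.m≤m+n _ 0))
        bound : k ^ d ≤ 1 + ∣ colourClass f κ ∩ tree ∣ + (d * k + 1) * total-impurity
        bound = begin
          k ^ d
            ≡⟨ ℕₚ.*-identityʳ (k ^ d) ⟨
          k ^ d * 1
            ≤⟨ *≤sum local ⟩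
          sum (λ v → 𝟙 (v ≟ u) + 𝟙 (hasDown? (distance u) f κ v) + cost d impurity u v)
            ≡⟨ ∑-distrib-+ (λ v → 𝟙 (v ≟ u) + 𝟙 (hasDown? (distance u) f κ v)) (cost d impurity u) ⟩
          sum (λ v → 𝟙 (v ≟ u) + 𝟙 (hasDown? (distance u) f κ v)) + sum (cost d impurity u)
            ≡⟨ cong (_+ sum (cost d impurity u))
                 (∑-distrib-+ (λ v → 𝟙 (v ≟ u)) (λ v → 𝟙 (hasDown? (distance u) f κ v))) ⟩
          count (_≟ u) + count (hasDown? (distance u) f κ) + sum (cost d impurity u)
            ≤⟨ ℕₚ.+-mono-≤ (ℕₚ.+-mono-≤ (count-unique≤1 (_≟ u) (λ _ _ p q → trans p (sym q))) count≤tree) cheap ⟩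
          1 + ∣ colourClass f κ ∩ tree ∣ + (d * k + 1) * total-impurity ∎
          where open ℕₚ.≤-Reasoning

      pure⇒biased : ∃[ i ] ∃[ T ] SpanningTree T ×
        k ^ d ≤ 1 + ∣ colourClass f i ∩ T ∣ + (d * k + 1) * total-impurity
      pure⇒biased =
        let u , cheap = cheap-centre d impurity
            open Centre u cheap
            open TreeFavouring (distance u) (down-or-root u) f κ
        in κ , tree , tree-spanning , bound

  -- Arithmetic of the two cases of the lower bound.

  pure-arithmetic : ∀ {d k r L M K} → 1 ≤ d → 4 ≤ k → 2 ≤ r → 1 ≤ K → 8 * d * M ≤ K →
                    k * K ≤ 1 + L + (d * k + 1) * M → K + k * K ≤ 1 + r * L
  pure-arithmetic {d} {k} {r} {L} {M} {K} 1≤d 4≤k 2≤r 1≤K small le =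
    ℕₚ.≤-trans (ℕₚ.*-cancelˡ-≤ 4 (ℕₚ.+-cancelʳ-≤ (4 + 2 * (k * K)) _ _ quadrupled))
               (ℕₚ.+-monoʳ-≤ 1 (ℕₚ.*-monoˡ-≤ L 2≤r))
    where
    open ℕₚ.≤-Reasoning
    n = k * K
    1≤dk : 1 ≤ d * k
    1≤dk = ℕₚ.*-mono-≤ 1≤d (ℕₚ.≤-trans (s≤s z≤n) 4≤k)
    -- The constant 8 is chosen so that the vertices written off are at most a quarter of all:
    -- `d * k + 1` is at most `2 * d * k`.
    impure-part : 4 * ((d * k + 1) * M) ≤ n
    impure-part = begin
      4 * ((d * k + 1) * M)          ≤⟨ ℕₚ.*-monoʳ-≤ 4 (ℕₚ.*-monoˡ-≤ M (ℕₚ.+-monoʳ-≤ (d * k) 1≤dk)) ⟩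
      4 * ((d * k + d * k) * M)    ≡⟨ regroup d k M ⟩
      k * (8 * d * M)                ≤⟨ ℕₚ.*-monoʳ-≤ k small ⟩
      n                                    ∎
      where
      regroup : ∀ d k M → 4 * ((d * k + d * k) * M) ≡ k * (8 * d * M)
      regroup = solve-∀
    4K≤n : 4 * K ≤ n
    4K≤n = ℕₚ.*-monoˡ-≤ K 4≤k
    -- Hence `L ≥ 3n/4 - 1` and `1 + 2L ≥ n + n/2 - 1`; the surplus suffices because `n/4` is at
    -- least `K` and at least 1. The factor 4 avoids fractions, the added `4 + 2 * n` avoids
    -- subtraction.
    quadrupled : 4 * (K + n) + (4 + 2 * n) ≤ 4 * (1 + 2 * L) + (4 + 2 * n)
    quadrupled = begin
      4 * (K + n) + (4 + 2 * n)                      ≡⟨ split K n ⟩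
      4 * K + (4 + 6 * n)                            ≤⟨ ℕₚ.+-mono-≤ 4K≤n (ℕₚ.+-monoˡ-≤ (6 * n)
                                                              (ℕₚ.*-mono-≤ 4≤k 1≤K)) ⟩
      n + (n + 6 * n)                                  ≡⟨ merge n ⟩
      2 * (4 * n)                                    ≤⟨ ℕₚ.*-monoʳ-≤ 2 (ℕₚ.*-monoʳ-≤ 4 le) ⟩
      2 * (4 * (1 + L + (d * k + 1) * M))        ≡⟨ isolate L ((d * k + 1) * M) ⟩
      8 + 8 * L + 2 * (4 * ((d * k + 1) * M))  ≤⟨ ℕₚ.+-monoʳ-≤ (8 + 8 * L) (ℕₚ.*-monoʳ-≤ 2 impure-part) ⟩
      8 + 8 * L + 2 * n                              ≡⟨ finish L n ⟩
      4 * (1 + 2 * L) + (4 + 2 * n)                ∎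
      where
      split : ∀ K n → 4 * (K + n) + (4 + 2 * n) ≡ 4 * K + (4 + 6 * n)
      split = solve-∀
      merge : ∀ n → n + (n + 6 * n) ≡ 2 * (4 * n)
      merge = solve-∀
      isolate : ∀ L i → 2 * (4 * (1 + L + i)) ≡ 8 + 8 * L + 2 * (4 * i)
      isolate = solve-∀
      finish : ∀ L n → 8 + 8 * L + 2 * n ≡ 4 * (1 + 2 * L) + (4 + 2 * n)
      finish = solve-∀

  impure-arithmetic : ∀ {d t n L r K M x} → K ≤ 8 * d * M → M ≤ t * x → n + x ≤ 1 + r * L →
                      K + 8 * d * t * n ≤ 8 * d * t * (1 + r * L)
  impure-arithmetic {d} {t} {n} {L} {r} {K} {M} {x} large M≤ le = begin
    K + q * n                       ≤⟨ ℕₚ.+-monoˡ-≤ (q * n) (ℕₚ.≤-trans large (ℕₚ.*-monoʳ-≤ (8 * d) M≤)) ⟩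
    8 * d * (t * x) + q * n   ≡⟨ regroup d t x n ⟩
    q * (n + x)                     ≤⟨ ℕₚ.*-monoʳ-≤ q le ⟩
    q * (1 + r * L)               ∎
    where
    open ℕₚ.≤-Reasoning
    q = 8 * d * t
    regroup : ∀ d t x n → 8 * d * (t * x) + 8 * d * t * n ≡ 8 * d * t * (n + x)
    regroup = solve-∀

  module LowerBound (m d : ℕ) (2≤d : 2 ≤ suc d) {r : ℕ} .{{_ : NonZero r}} (2≤r : 2 ≤ r) where
    -- The side length is `k = 4 + m`, as `pure-arithmetic` asks for at least 4.
    open GridColouring (2 + m) (suc d) 2≤d
    open Graph (grid k (suc d))

    q K : ℕ
    q = 8 * suc d * 2 ^ suc d
    K = k ^ d

    1≤K : 1 ≤ K
    1≤K = ℕₚ.m^n>0 k d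

    1≤q : 1 ≤ q
    1≤q = ℕₚ.*-mono-≤ {1} {8 * suc d} (s≤s z≤n) (ℕₚ.m^n>0 2 (suc d))

    biased-tree : ∀ (f : Colouring r) → ∃[ i ] ∃[ T ] SpanningTree T ×
      K + q * (k ^ suc d) ≤ q * (1 + r * ∣ colourClass f i ∩ T ∣)
    -- The impure case gives only the excess `K / q`; the pure case gives `K` and is weakened to the
    -- same form.
    biased-tree f = [ pure , impure ]′ (ℕₚ.≤-total (8 * suc d * total-impurity f) K)
      where
      Result = ∃[ i ] ∃[ T ] SpanningTree T ×
        K + q * (k ^ suc d) ≤ q * (1 + r * ∣ colourClass f i ∩ T ∣)
      impure : K ≤ 8 * suc d * total-impurity f → Result
      impure large =
        let i , T , _ , st , M≤ , le = impure⇒biased f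
        in i , T , st , impure-arithmetic {suc d} {2 ^ suc d} {k ^ suc d} {r = r} large M≤ le
      pure : 8 * suc d * total-impurity f ≤ K → Result
      pure small =
        let i , T , st , le = pure⇒biased f
            le′ = pure-arithmetic {suc d} {k} {r} (s≤s z≤n) (s≤s (s≤s (s≤s (s≤s z≤n)))) 2≤r 1≤K small le
        in i , T , st , ℕₚ.≤-trans
             (ℕₚ.≤-trans (ℕₚ.+-monoˡ-≤ (q * (k ^ suc d)) (ℕₚ.m≤n*m K q {{ℕ.>-nonZero 1≤q}}))
                         (ℕₚ.≤-reflexive (sym (ℕₚ.*-distribˡ-+ q K (k ^ suc d)))))
             (ℕₚ.*-monoʳ-≤ q le′)

  -- The slab colouring for the upper bound.

  module UpperBound (k d : ℕ) (r : ℕ) .{{_ : NonZero r}} where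
    open Lattice k
    open Graph (grid k (suc d))
    open GraphProperties (grid k (suc d))
    open Components (grid k (suc d)) using (forest-bound)

    width : ℕ
    width = suc (k / r)

    k<r*width : k < r * width
    k<r*width = begin-strict
      k                      ≡⟨ m≡m%n+[m/n]*n k r ⟩
      k % r + (k / r) * r  <⟨ ℕₚ.+-monoˡ-< ((k / r) * r) (m%n<n k r) ⟩
      r + (k / r) * r      ≡⟨ ℕₚ.*-comm width r ⟩
      r * width            ∎
      where open ℕₚ.≤-Reasoning

    layer : Fin (k ^ suc d) → ℕ
    layer v = toℕ (head d v)

    slab< : ∀ v → layer v / width < r
    slab< v = m<n*o⇒m/o<n {layer v} {r} {width} (ℕₚ.<-trans (Finₚ.toℕ<n (head d v)) k<r*width)

    slabs : Colouring r
    slabs e = Fin.fromℕ< (slab< (proj₁ (ends e)))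

    -- The lowest layer of the widened slab. For slab 0 the subtraction truncates and nothing is
    -- added below, so `InSlab` then reaches one layer further up, which does no harm.
    floor : Fin r → ℕ
    floor i = toℕ i * width ∸ 1

    InSlab : Fin r → Fin k → Set
    InSlab i x = floor i ≤ toℕ x × toℕ x < floor i + (2 + width)

    inSlab? : ∀ i x → Dec (InSlab i x)
    inSlab? i x = (floor i ℕₚ.≤? toℕ x) ×-dec (toℕ x ℕₚ.<? floor i + (2 + width))

    count-slab : ∀ i → count (inSlab? i ∘ head d) ≤ (2 + width) * k ^ d
    count-slab i = begin
      count (inSlab? i ∘ head d)
        ≡⟨ sum-combine k (λ v → 𝟙 (inSlab? i (head d v))) ⟩
      sum {k} (λ x → sum (λ t → 𝟙 (inSlab? i (head d (cons d x t)))))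
        ≡⟨ sum-cong-≗ {k} (λ x → trans
             (sum-cong-≗ (λ t → cong (λ y → 𝟙 (inSlab? i y)) (head-cons d x t)))
             (sum-const (k ^ d) (𝟙 (inSlab? i x)))) ⟩
      sum {k} (λ x → k ^ d * 𝟙 (inSlab? i x))
        ≡⟨ sum-*ˡ (k ^ d) (λ x → 𝟙 (inSlab? i x)) ⟩
      k ^ d * count (inSlab? i)
        ≤⟨ ℕₚ.*-monoʳ-≤ (k ^ d) (count-interval k (floor i) (2 + width)) ⟩
      k ^ d * (2 + width)
        ≡⟨ ℕₚ.*-comm (k ^ d) (2 + width) ⟩
      (2 + width) * k ^ d ∎
      where open ℕₚ.≤-Reasoning

    neighbours-layer : ∀ {u v} → Neighbours (suc d) u v → layer v ≤ suc (layer u) × layer u ≤ suc (layer v)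
    neighbours-layer {u} {v} (zero , eq , _) with ∣-∣≡1 (layer u) (layer v) eq
    ... | inj₁ p = ℕₚ.m≤n⇒m≤1+n (ℕₚ.≤-trans (ℕₚ.n≤1+n _) (ℕₚ.≤-reflexive (sym p))) , ℕₚ.≤-reflexive p
    ... | inj₂ p = ℕₚ.≤-reflexive p , ℕₚ.m≤n⇒m≤1+n (ℕₚ.≤-trans (ℕₚ.n≤1+n _) (ℕₚ.≤-reflexive (sym p)))
    neighbours-layer {u} {v} (suc a , _ , same) =
      subst (_≤ suc (layer u)) (cong toℕ (same zero λ ())) (ℕₚ.n≤1+n _) ,
      subst (λ x → layer u ≤ suc x) (cong toℕ (same zero λ ())) (ℕₚ.n≤1+n _)

    -- The slab of colour i is widened by one layer on each side, to also contain
    -- the edges leaving it.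
    ends-in-slab : ∀ e → InSlab (slabs e) (head d (proj₁ (ends e))) × InSlab (slabs e) (head d (proj₂ (ends e)))
    ends-in-slab e =
      (ℕₚ.≤-trans (ℕₚ.m∸n≤m _ 1) start≤ , ℕₚ.<-≤-trans <stop (ℕₚ.+-monoʳ-≤ (floor i) (ℕₚ.n≤1+n _))) ,
      (ℕₚ.∸-monoˡ-≤ 1 (ℕₚ.≤-trans start≤ (proj₂ near)) , ℕₚ.≤-<-trans (proj₁ near)
        (ℕₚ.<-≤-trans (s≤s <stop) (ℕₚ.≤-reflexive (sym (ℕₚ.+-suc (floor i) (1 + width))))))
      where
      i = slabs e
      x = layer (proj₁ (ends e))
      near = neighbours-layer {proj₁ (ends e)} {proj₂ (ends e)} (proj₂ (ends-valid e))
      i≡ : toℕ i ≡ x / width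
      i≡ = Finₚ.toℕ-fromℕ< (slab< (proj₁ (ends e)))
      start≤ : toℕ i * width ≤ x
      start≤ = subst (λ j → j * width ≤ x) (sym i≡) (m/n*n≤m x width)
      <stop : x < floor i + (1 + width)
      <stop = begin-strict
        x                                    ≡⟨ m≡m%n+[m/n]*n x width ⟩
        x % width + (x / width) * width    <⟨ ℕₚ.+-monoˡ-< _ (m%n<n x width) ⟩
        width + (x / width) * width        ≡⟨ cong (λ j → width + j * width) i≡ ⟨
        width + toℕ i * width              ≤⟨ ℕₚ.+-monoʳ-≤ width (ℕₚ.m≤n+m∸n _ 1) ⟩
        width + (1 + floor i)                ≡⟨ shuffle width (floor i) ⟩
        floor i + (1 + width)                ∎
        where
        open ℕₚ.≤-Reasoning
        shuffle : ∀ w b → w + (1 + b) ≡ b + (1 + w)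
        shuffle = solve-∀

    colour-bound : ∀ {T} → SpanningTree T → ∀ i →
                   ∣ colourClass slabs i ∩ T ∣ ≤ (2 + width) * k ^ d
    colour-bound {T} (_ , acyclic) i = ℕₚ.≤-trans
      (forest-bound acyclic (inSlab? i ∘ head d) (colourClass slabs i ∩ T) inside) (count-slab i)
      where
      inside : ∀ {e} → e ∈ colourClass slabs i ∩ T →
               e ∈ T × InSlab i (head d (proj₁ (ends e))) × InSlab i (head d (proj₂ (ends e)))
      inside {e} e∈ =
        let e∈class , e∈T = x∈p∩q⁻ (colourClass slabs i) T e∈
        in e∈T , subst (λ j → InSlab j (head d (proj₁ (ends e))) × InSlab j (head d (proj₂ (ends e))))
                   (∈-tabulate-does⁻ (λ e → slabs e ≟ i) e∈class) (ends-in-slab e)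

    -- Rounding up the width costs one layer per colour and widening two more; rounding down in
    -- `k / r` works in favour of the bound.
    scaled-bound : r * ((2 + width) * k ^ d) ≤ k ^ suc d + 3 * r * k ^ d
    scaled-bound = begin
      r * ((3 + k / r) * k ^ d)
        ≡⟨ expand r (k / r) (k ^ d) ⟩
      (k / r) * r * k ^ d + 3 * r * k ^ d
        ≤⟨ ℕₚ.+-monoˡ-≤ _ (ℕₚ.*-monoˡ-≤ (k ^ d) (m/n*n≤m k r)) ⟩
      k ^ suc d + 3 * r * k ^ d ∎
      where
      open ℕₚ.≤-Reasoning
      expand : ∀ r s K → r * ((3 + s) * K) ≡ s * r * K + 3 * r * K
      expand = solve-∀

-- From inequalities between naturals to rational bounds on the discrepancy.

open import Data.Integer using (+_)
open import Data.Rational using (ℚ; 0ℚ; _/_; _*_; _≤_; _<_)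

toℚᵘ-/ : ∀ z n .{{_ : NonZero n}} → ℚ.toℚᵘ (z / n) ≃ z ℚᵘ./ n
toℚᵘ-/ z (suc n) = ℚₚ.toℚᵘ-fromℚᵘ (mkℚᵘ z n)

/-*-/ : ∀ a b c d .{{_ : NonZero b}} .{{_ : NonZero d}} .{{_ : NonZero (b ℕ.* d)}} →
        (a / b) ℚ.* (c / d) ≡ (a ℤ.* c) / (b ℕ.* d)
/-*-/ a b@(suc _) c d@(suc _) = ℚₚ.toℚᵘ-injective (begin
  ℚ.toℚᵘ ((a / b) ℚ.* (c / d))              ≈⟨ ℚₚ.toℚᵘ-homo-* (a / b) (c / d) ⟩
  ℚ.toℚᵘ (a / b) ℚᵘ.* ℚ.toℚᵘ (c / d)        ≈⟨ ℚᵘₚ.*-cong (toℚᵘ-/ a b) (toℚᵘ-/ c d) ⟩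
  (a ℚᵘ./ b) ℚᵘ.* (c ℚᵘ./ d)                ≈⟨ ℚᵘₚ.≃-refl ⟩
  (a ℤ.* c) ℚᵘ./ (b ℕ.* d)                  ≈⟨ toℚᵘ-/ (a ℤ.* c) (b ℕ.* d) ⟨
  ℚ.toℚᵘ ((a ℤ.* c) / (b ℕ.* d))            ∎)
  where open import Relation.Binary.Reasoning.Setoid ℚᵘₚ.≃-setoid

/-mono-≤ : ∀ a b c d .{{_ : NonZero b}} .{{_ : NonZero d}} →
           a ℤ.* + d ℤ.≤ c ℤ.* + b → a / b ℚ.≤ c / d
/-mono-≤ a b@(suc _) c d@(suc _) le = ℚₚ.toℚᵘ-cancel-≤ (begin
  ℚ.toℚᵘ (a / b)  ≃⟨ toℚᵘ-/ a b ⟩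
  a ℚᵘ./ b        ≤⟨ *≤* le ⟩
  c ℚᵘ./ d        ≃⟨ toℚᵘ-/ c d ⟨
  ℚ.toℚᵘ (c / d)  ∎)
  where open ℚᵘₚ.≤-Reasoning

/-cong-≃ : ∀ a b c d .{{_ : NonZero b}} .{{_ : NonZero d}} →
           a ℤ.* + d ≡ c ℤ.* + b → a / b ≡ c / d
/-cong-≃ a b c d eq =
  ℚₚ.≤-antisym (/-mono-≤ a b c d (ℤₚ.≤-reflexive eq)) (/-mono-≤ c d a b (ℤₚ.≤-reflexive (sym eq)))

/1-‿- : ∀ a b → (a / 1) ℚ.- (b / 1) ≡ (a ℤ.- b) / 1
/1-‿- a b = ℚₚ.toℚᵘ-injective (begin
  ℚ.toℚᵘ ((a / 1) ℚ.- (b / 1))                ≈⟨ ℚₚ.toℚᵘ-homo-+ (a / 1) (ℚ.- (b / 1)) ⟩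
  ℚ.toℚᵘ (a / 1) ℚᵘ.+ ℚ.toℚᵘ (ℚ.- (b / 1))    ≈⟨ ℚᵘₚ.+-congʳ (ℚ.toℚᵘ (a / 1)) (ℚₚ.toℚᵘ-homo‿- (b / 1)) ⟩
  ℚ.toℚᵘ (a / 1) ℚᵘ.- ℚ.toℚᵘ (b / 1)          ≈⟨ ℚᵘₚ.+-cong (toℚᵘ-/ a 1) (ℚᵘₚ.-‿cong (toℚᵘ-/ b 1)) ⟩
  (a ℚᵘ./ 1) ℚᵘ.- (b ℚᵘ./ 1)                  ≈⟨ *≡* (unit a b) ⟩
  (a ℤ.- b) ℚᵘ./ 1                            ≈⟨ toℚᵘ-/ (a ℤ.- b) 1 ⟨
  ℚ.toℚᵘ ((a ℤ.- b) / 1)                      ∎)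
  where
  open import Relation.Binary.Reasoning.Setoid ℚᵘₚ.≃-setoid
  unit : ∀ a b → (a ℤ.* + 1 ℤ.+ (ℤ.- b) ℤ.* + 1) ℤ.* + 1 ≡ (a ℤ.- b) ℤ.* + 1
  unit = ℤSolver.solve-∀

-- At `z = n - 1` the left side is the discrepancy of a tree with largest class `L`. It is thus an
-- integer, and what remains is integer arithmetic.
scaled-difference : ∀ r L z .{{_ : NonZero r}} →
  (+ r / 1) ℚ.* ((+ L / 1) ℚ.- (z / r)) ≡ (+ r ℤ.* + L ℤ.- z) / 1
scaled-difference r L z = begin
  (+ r / 1) ℚ.* ((+ L / 1) ℚ.- (z / r))
    ≡⟨ ℚₚ.*-distribˡ-+ (+ r / 1) (+ L / 1) (ℚ.- (z / r)) ⟩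
  (+ r / 1) ℚ.* (+ L / 1) ℚ.+ (+ r / 1) ℚ.* (ℚ.- (z / r))
    ≡⟨ cong₂ ℚ._+_ (/-*-/ (+ r) 1 (+ L) 1)
         (trans (sym (ℚₚ.neg-distribʳ-* (+ r / 1) (z / r))) (cong ℚ.-_ cancel)) ⟩
  ((+ r ℤ.* + L) / 1) ℚ.- (z / 1)
    ≡⟨ /1-‿- (+ r ℤ.* + L) z ⟩
  (+ r ℤ.* + L ℤ.- z) / 1 ∎
  where
  open ≡-Reasoning
  instance
    1*r≢0 : NonZero (1 ℕ.* r)
    1*r≢0 = ℕₚ.m*n≢0 1 r
  cancel : (+ r / 1) ℚ.* (z / r) ≡ z / 1
  cancel = trans (/-*-/ (+ r) 1 z r) (/-cong-≃ (+ r ℤ.* z) (1 ℕ.* r) z 1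
    (trans (ℤₚ.*-identityʳ (+ r ℤ.* z)) (trans (ℤₚ.*-comm (+ r) z)
      (cong (λ m → z ℤ.* + m) (sym (ℕₚ.*-identityˡ r))))))

lower-cast : ∀ {q K n r L} .{{_ : NonZero q}} → K ℕ.+ q ℕ.* n ℕ.≤ q ℕ.* (1 ℕ.+ r ℕ.* L) →
             (+ 1 / q) ℚ.* (+ K / 1) ℚ.≤ (+ r ℤ.* + L ℤ.- (+ n ℤ.- ℤ.1ℤ)) / 1
lower-cast {q} {K} {n} {r} {L} le = subst (ℚ._≤ ((+ r ℤ.* + L ℤ.- (+ n ℤ.- ℤ.1ℤ)) / 1))
  (sym (/-*-/ (+ 1) q (+ K) 1))
  (/-mono-≤ (+ 1 ℤ.* + K) (q ℕ.* 1) (+ r ℤ.* + L ℤ.- (+ n ℤ.- ℤ.1ℤ)) 1 (begin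
    + 1 ℤ.* + K ℤ.* + 1
      ≡⟨ isolate (+ K) (+ q) (+ n) ⟩
    + K ℤ.+ + q ℤ.* + n ℤ.- + q ℤ.* + n
      ≤⟨ ℤₚ.+-monoˡ-≤ (ℤ.- (+ q ℤ.* + n)) le′ ⟩
    + q ℤ.* (+ 1 ℤ.+ + r ℤ.* + L) ℤ.- + q ℤ.* + n
      ≡⟨ collect (+ q) (+ r) (+ L) (+ n) ⟩
    (+ r ℤ.* + L ℤ.- (+ n ℤ.- ℤ.1ℤ)) ℤ.* + q
      ≡⟨ cong (λ m → (+ r ℤ.* + L ℤ.- (+ n ℤ.- ℤ.1ℤ)) ℤ.* + m) (ℕₚ.*-identityʳ q) ⟨
    (+ r ℤ.* + L ℤ.- (+ n ℤ.- ℤ.1ℤ)) ℤ.* + (q ℕ.* 1) ∎))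
  where
  open ℤₚ.≤-Reasoning
  instance
    q*1≢0 : NonZero (q ℕ.* 1)
    q*1≢0 = ℕₚ.m*n≢0 q 1
  isolate : ∀ K q n → + 1 ℤ.* K ℤ.* + 1 ≡ K ℤ.+ q ℤ.* n ℤ.- q ℤ.* n
  isolate = ℤSolver.solve-∀
  collect : ∀ q r L n → q ℤ.* (+ 1 ℤ.+ r ℤ.* L) ℤ.- q ℤ.* n ≡ (r ℤ.* L ℤ.- (n ℤ.- + 1)) ℤ.* q
  collect = ℤSolver.solve-∀
  le′ : + K ℤ.+ + q ℤ.* + n ℤ.≤ + q ℤ.* (+ 1 ℤ.+ + r ℤ.* + L)
  le′ = subst₂ ℤ._≤_ (cong (λ x → + K ℤ.+ x) (ℤₚ.pos-* q n))
    (trans (ℤₚ.pos-* q _) (cong (λ x → + q ℤ.* (+ 1 ℤ.+ x)) (ℤₚ.pos-* r L))) (ℤ.+≤+ le)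

upper-cast : ∀ {C K n r L} → r ℕ.* L ℕ.+ 1 ℕ.≤ n ℕ.+ C ℕ.* K →
             (+ r ℤ.* + L ℤ.- (+ n ℤ.- ℤ.1ℤ)) / 1 ℚ.≤ (+ C / 1) ℚ.* (+ K / 1)
upper-cast {C} {K} {n} {r} {L} le = subst (((+ r ℤ.* + L ℤ.- (+ n ℤ.- ℤ.1ℤ)) / 1) ℚ.≤_)
  (sym (/-*-/ (+ C) 1 (+ K) 1))
  (/-mono-≤ (+ r ℤ.* + L ℤ.- (+ n ℤ.- ℤ.1ℤ)) 1 (+ C ℤ.* + K) 1 (ℤₚ.*-monoʳ-≤-nonNeg (+ 1) (begin
    + r ℤ.* + L ℤ.- (+ n ℤ.- ℤ.1ℤ)      ≡⟨ regroup (+ r) (+ L) (+ n) ⟩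
    + r ℤ.* + L ℤ.+ + 1 ℤ.- + n          ≤⟨ ℤₚ.+-monoˡ-≤ (ℤ.- + n) le′ ⟩
    + n ℤ.+ + C ℤ.* + K ℤ.- + n          ≡⟨ cancel (+ n) (+ C) (+ K) ⟩
    + C ℤ.* + K                          ∎)))
  where
  open ℤₚ.≤-Reasoning
  regroup : ∀ r L n → r ℤ.* L ℤ.- (n ℤ.- + 1) ≡ r ℤ.* L ℤ.+ + 1 ℤ.- n
  regroup = ℤSolver.solve-∀
  cancel : ∀ n C K → n ℤ.+ C ℤ.* K ℤ.- n ≡ C ℤ.* K
  cancel = ℤSolver.solve-∀
  le′ : + r ℤ.* + L ℤ.+ + 1 ℤ.≤ + n ℤ.+ + C ℤ.* + K
  le′ = subst₂ ℤ._≤_ (cong (ℤ._+ + 1) (ℤₚ.pos-* r L)) (cong (λ x → + n ℤ.+ x) (ℤₚ.pos-* C K)) (ℤ.+≤+ le)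

module DiscrepancyBounds {n} (G : Graph n) {r : ℕ} .{{_ : NonZero r}} where
  open Graph G

  -- The hypothesis is applied to a colouring that attains `D`; its biased tree is one of those over
  -- which the maximum is taken.
  discrepancy-lower : ∀ q K .{{_ : NonZero q}} →
    (∀ (f : Colouring r) → ∃[ i ] ∃[ T ] SpanningTree T ×
      K ℕ.+ q ℕ.* n ℕ.≤ q ℕ.* (1 ℕ.+ r ℕ.* ∣ colourClass f i ∩ T ∣)) →
    ∀ {D} → IsDiscrepancy G r D → (+ 1 / q) * (+ K / 1) ≤ D
  discrepancy-lower q K biased ((f , _ , upper) , _) =
    let i , T , st , le = biased f
        class≤largest = Allₚ.tabulate⁻ (xs≤max 0 _) i
    in ℚₚ.≤-trans
      (subst ((+ 1 / q) * (+ K / 1) ≤_) (sym (scaled-difference r (largestClass f T) (+ n ℤ.- ℤ.1ℤ)))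
        (lower-cast {q} {K} {n} {r} {largestClass f T}
          (ℕₚ.≤-trans le (ℕₚ.*-monoʳ-≤ q (ℕₚ.+-monoʳ-≤ 1 (ℕₚ.*-monoʳ-≤ r class≤largest))))))
      (upper _ (T , st , refl))

  discrepancy-upper : ∀ {B} C K (f : Colouring r) → ∃[ T ] SpanningTree T →
    (∀ {T} → SpanningTree T → ∀ i → ∣ colourClass f i ∩ T ∣ ℕ.≤ B) →
    r ℕ.* B ℕ.+ 1 ℕ.≤ n ℕ.+ C ℕ.* K →
    ∀ {D} → IsDiscrepancy G r D → D ≤ (+ C / 1) * (+ K / 1)
  discrepancy-upper C K f spanned class≤ le (_ , lower) =
    let M , M-max = Extremes.max-exists G spanned f
        (T , st , M≡) , _ = M-max
        -- `z≤n` disposes of the default value 0 of `max`.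
        largest≤ = max≤v⁺ z≤n (Allₚ.tabulate⁺ (class≤ st))
    in ℚₚ.≤-trans (lower M (f , M-max))
      (subst (_≤ (+ C / 1) * (+ K / 1))
        (sym (trans M≡ (scaled-difference r (largestClass f T) (+ n ℤ.- ℤ.1ℤ))))
        (upper-cast {C} {K} {n} {r} {largestClass f T}
          (ℕₚ.≤-trans (ℕₚ.+-monoˡ-≤ 1 (ℕₚ.*-monoʳ-≤ r largest≤)) le)))

corollary1p9 : (r d : ℕ) .{{_ : NonZero r}} → 2 ℕ.≤ r → 2 ℕ.≤ d →
    ∃[ c ] ∃[ C ] ∃[ K ] 0ℚ < c × 0ℚ < C × (∀ (k : ℕ) → K ℕ.≤ k →
    ∃[ D ] IsDiscrepancy (grid k d) r D
    × c * (+ (k ℕ.^ (d ℕ.∸ 1)) / 1) ≤ D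
    × D ≤ C * (+ (k ℕ.^ (d ℕ.∸ 1)) / 1))
corollary1p9 r (suc d) 2≤r 2≤d =
  -- `q` combines the impurity threshold with the average over the corners. In `C`, `3 * r` comes
  -- from `scaled-bound`, and one more `k ^ d` absorbs the 1 in `n - 1`. The threshold 4 comes from
  -- `pure-arithmetic`.
  + 1 / q , + C / 1 , 4 ,
  ℚₚ.positive⁻¹ (+ 1 / q) {{ℚₚ.normalize-pos 1 q}} ,
  ℚₚ.positive⁻¹ (+ C / 1) {{ℚₚ.normalize-pos C 1}} ,
  bounds
  where
  q C : ℕ
  q = 8 ℕ.* suc d ℕ.* 2 ℕ.^ suc d
  C = suc (3 ℕ.* r)
  instance
    q≢0 : NonZero q
    q≢0 = ℕₚ.m*n≢0 (8 ℕ.* suc d) (2 ℕ.^ suc d) {{_}} {{ℕₚ.m^n≢0 2 (suc d)}}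
  bounds : ∀ k → 4 ℕ.≤ k → ∃[ D ] IsDiscrepancy (grid k (suc d)) r D
    × (+ 1 / q) * (+ (k ℕ.^ d) / 1) ≤ D × D ≤ (+ C / 1) * (+ (k ℕ.^ d) / 1)
  bounds k@(suc (suc (suc (suc m)))) (s≤s (s≤s (s≤s (s≤s z≤n)))) =
    let D , D-min = Extremes.discrepancy-exists (grid k (suc d)) spanned
    in D , D-min , discrepancy-lower q (k ℕ.^ d) biased-tree D-min ,
       discrepancy-upper C (k ℕ.^ d) slabs spanned colour-bound room D-min
    where
    open LowerBound m d 2≤d {r} 2≤r using (biased-tree)
    open UpperBound k d r using (slabs; width; colour-bound; scaled-bound)
    open DiscrepancyBounds (grid k (suc d)) {r}
    spanned : ∃[ T ] Graph.SpanningTree (grid k (suc d)) T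
    -- Any colouring would do here: the lower bound constructs a spanning tree for each.
    spanned = let _ , T , st , _ = biased-tree slabs in T , st
    room : r ℕ.* ((2 ℕ.+ width) ℕ.* k ℕ.^ d) ℕ.+ 1 ℕ.≤ k ℕ.^ suc d ℕ.+ C ℕ.* k ℕ.^ d
    room = begin
      r ℕ.* ((2 ℕ.+ width) ℕ.* k ℕ.^ d) ℕ.+ 1
        ≤⟨ ℕₚ.+-mono-≤ scaled-bound (ℕₚ.m^n>0 k d) ⟩
      k ℕ.^ suc d ℕ.+ 3 ℕ.* r ℕ.* k ℕ.^ d ℕ.+ k ℕ.^ d
        ≡⟨ regroup (k ℕ.^ suc d) (3 ℕ.* r) (k ℕ.^ d) ⟩
      k ℕ.^ suc d ℕ.+ C ℕ.* k ℕ.^ d ∎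
      where
      open ℕₚ.≤-Reasoning
      regroup : ∀ n c K → n ℕ.+ c ℕ.* K ℕ.+ K ≡ n ℕ.+ suc c ℕ.* K
      regroup = solve-∀
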